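{- Let $p\geq 2$ and let $G$ be a finite simple $\{pK_2, \mathrm{gem}^+\}$-free graph. Then $\chi(G)\leq f_p(\omega(G))$, where $f_p:\mathbb{N}\to\mathbb{N}$ ($p\geq2$) is defined by: $f_t(1)=1$ for $t\geq2$; $f_2(2)=3$; $f_2(3)=4$; $f_2(s)=\binom{s+1}{2}$ for $s\geq 4$; $f_p(2)=2p-2$ for $p\geq 3$; and $f_p(m)=f_{p-1}(m)+\binom{m+1}{2}+m-2$ for $m,p\geq 3$.
   Context: $\chi(G)$ is the chromatic number and $\omega(G)$ the clique number of $G$. $pK_2$ is the disjoint union of $p$ edges. $\mathrm{gem}^+$ is the graph on six vertices $K_1+(P_4\cup K_1)$: a vertex adjacent to all vertices of a path $P_4$ and to one further vertex, the latter having no other neighbours (i.e. a gem with a pendant vertex attached to its dominating vertex). A graph is $\mathcal{F}$-free if it has no induced subgraph isomorphic to a member of $\mathcal{F}$. -}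

module Defs where

open import Data.Nat using (ℕ; zero; suc; _+_; _*_; _∸_; _≤_; _≡ᵇ_)
open import Data.Nat.Combinatorics using (_C_)
open import Data.Nat.DivMod using (_/_)
open import Data.Bool using (Bool; true; false; _∧_; _∨_; not)
open import Data.Fin using (Fin; toℕ)
open import Data.Product using (Σ; _×_; ∃)
open import Relation.Binary.PropositionalEquality using (_≡_; _≢_)
open import Function.Definitions using (Injective)

record Graph (n : ℕ) : Set where
  field
    adj    : Fin n → Fin n → Bool
    sym    : ∀ u v → adj u v ≡ adj v u
    irrefl : ∀ v → adj v v ≡ false
open Graph public

InducedSub : ∀ {k n} → Graph k → Graph n → Set
InducedSub {k} {n} H G =
  Σ (Fin k → Fin n) λ f → Injective _≡_ _≡_ f ×
    (∀ i j → adj G (f i) (f j) ≡ adj H i j)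

-- pK₂ : disjoint union of p edges; vertex i lies in edge ⌊i/2⌋.
pK2-adj : ℕ → ℕ → Bool
pK2-adj a b = ((a / 2) ≡ᵇ (b / 2)) ∧ not (a ≡ᵇ b)

pK2 : (p : ℕ) → Graph (p + p)
pK2 p = record
  { adj = λ i j → pK2-adj (toℕ i) (toℕ j)
  ; sym = λ i j → symm (toℕ i) (toℕ j)
  ; irrefl = λ i → irr (toℕ i) }
  where
  open import Relation.Binary.PropositionalEquality using (refl; cong₂; cong)
  eqb-sym : ∀ a b → (a ≡ᵇ b) ≡ (b ≡ᵇ a)
  eqb-sym zero zero = refl
  eqb-sym zero (suc b) = refl
  eqb-sym (suc a) zero = refl
  eqb-sym (suc a) (suc b) = eqb-sym a b
  eqb-refl : ∀ a → (a ≡ᵇ a) ≡ true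
  eqb-refl zero = refl
  eqb-refl (suc a) = eqb-refl a
  symm : ∀ a b → pK2-adj a b ≡ pK2-adj b a
  symm a b = cong₂ (λ x y → x ∧ not y) (eqb-sym (a / 2) (b / 2)) (eqb-sym a b)
  irr : ∀ a → pK2-adj a a ≡ false
  irr a rewrite eqb-refl a | eqb-refl (a / 2) = refl

-- gem⁺ = K₁ + (P₄ ∪ K₁): path 0-1-2-3, vertex 4 adjacent to 0,1,2,3,5;
-- vertex 5 pendant at 4.
gem⁺-E : ℕ → ℕ → Bool
gem⁺-E 0 1 = true
gem⁺-E 1 2 = true
gem⁺-E 2 3 = true
gem⁺-E 4 0 = true
gem⁺-E 4 1 = true
gem⁺-E 4 2 = true
gem⁺-E 4 3 = true
gem⁺-E 4 5 = true
gem⁺-E _ _ = false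

gem⁺ : Graph 6
gem⁺ = record
  { adj = λ i j → gem⁺-E (toℕ i) (toℕ j) ∨ gem⁺-E (toℕ j) (toℕ i)
  ; sym = λ i j → ∨-comm (gem⁺-E (toℕ i) (toℕ j)) (gem⁺-E (toℕ j) (toℕ i))
  ; irrefl = irr }
  where
  open import Relation.Binary.PropositionalEquality using (refl)
  open import Data.Bool.Properties using (∨-comm)
  open import Data.Fin using (zero; suc)
  irr : ∀ v → (gem⁺-E (toℕ v) (toℕ v) ∨ gem⁺-E (toℕ v) (toℕ v)) ≡ false
  irr zero = refl
  irr (suc zero) = refl
  irr (suc (suc zero)) = refl
  irr (suc (suc (suc zero))) = refl
  irr (suc (suc (suc (suc zero)))) = refl
  irr (suc (suc (suc (suc (suc zero))))) = refl

Free : ∀ {k n} → Graph k → Graph n → Set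
Free H G = InducedSub H G → ⊥′
  where open import Data.Empty renaming (⊥ to ⊥′)

HasClique : ∀ {n} → Graph n → ℕ → Set
HasClique {n} G k =
  Σ (Fin k → Fin n) λ f → Injective _≡_ _≡_ f ×
    (∀ i j → i ≢ j → adj G (f i) (f j) ≡ true)

IsCliqueNumber : ∀ {n} → Graph n → ℕ → Set
IsCliqueNumber G w = HasClique G w × (∀ k → HasClique G k → k ≤ w)

-- Proper colouring with m colours; χ(G) ≤ m iff one exists.
Colourable : ∀ {n} → Graph n → ℕ → Set
Colourable {n} G m =
  Σ (Fin n → Fin m) λ c → ∀ u v → adj G u v ≡ true → c u ≢ c v

f₂ : ℕ → ℕ
f₂ 0 = 0            -- convention (ω = 0 only for the empty graph)
f₂ 1 = 1
f₂ 2 = 3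
f₂ 3 = 4
f₂ s = suc s C 2

-- f p m  is  f_p(m)  (p ≥ 2; values for p < 2 are irrelevant junk = 0)
f : ℕ → ℕ → ℕ
f 0 _ = 0
f 1 _ = 0
f 2 m = f₂ m
f (suc (suc (suc p))) 0 = 0   -- convention, as above
f (suc (suc (suc p))) 1 = 1
f (suc (suc (suc p))) 2 = 2 * (3 + p) ∸ 2
f (suc (suc (suc p))) (suc (suc (suc k))) =
  f (suc (suc p)) m + suc m C 2 + m ∸ 2
  where m = suc (suc (suc k))

{-# OPTIONS --safe #-}

-- Let m bound the clique number and let uv be an edge. The common non-neighbours of u and v contain no (p-1)K₂, so
-- induction on p colours them. Since G has no gem⁺, N(u) \ N(v) contains no P₄ (v would be the pendant vertex), and
-- P₄-free graphs are perfect: a maximal independent set meets every maximum clique. The same holds for N(v) \ N(u),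
-- while N(u) ∩ N(v) contains no P₄ ∪ K₁ and has clique number at most m - 2, so C(m-1, 2) colours suffice there.
-- For p = 2 Wagon's bound C(m+1, 2) applies.
--
-- Two small cases need 4-colourings: p = 2, m = 3 and p = 3, m = 2. Call a pattern (a small induced subgraph) closed
-- if every graph of the class that contains it is 4-colourable. Patterns are closed one after the other, either by
-- colouring each vertex according to its adjacency to the pattern, where two adjacent vertices of the same colour
-- would create a pattern already closed, or, for p = 3, by growing the pattern with a pentagon that exists unless
-- the common non-neighbours of some edge induce a bipartite graph.

module Submission where

open import Defs renaming (sym to adj-sym; irrefl to adj-irrefl)
open import Axiom.UniquenessOfIdentityProofs using (module Decidable⇒UIP)
open import Data.Bool using (Bool; true; false; _∧_; _∨_; not; T)
import Data.Bool.Properties as Boolₚ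
open import Data.Bool.ListAction using (any; all)
open import Data.Empty using (⊥; ⊥-elim)
open import Data.Fin using (Fin; zero; suc; toℕ; inject≤; splitAt; _↑ˡ_; _↑ʳ_)
import Data.Fin as Fin
open import Data.Fin.Patterns using (0F; 1F; 2F; 3F)
import Data.Fin.Properties as Finₚ
open import Data.List using (List; []; _∷_; _++_; map; concatMap; upTo; allFin)
open import Data.List.Membership.Propositional using (_∈_; lose; find)
open import Data.List.Membership.Propositional.Properties using (∈-concatMap⁺; ∈-allFin; ∈-++⁺ˡ; ∈-++⁺ʳ)
open import Data.List.Relation.Unary.All using (All; []; _∷_)
import Data.List.Relation.Unary.All as All
import Data.List.Relation.Unary.All.Properties as Allₚ
open import Data.List.Relation.Unary.Any using (Any; here; there; any?; satisfied)
open import Data.Nat using (ℕ; zero; suc; _+_; _∸_; _≤_; _<_; z≤n; s≤s; s≤s⁻¹; _≡ᵇ_; _<ᵇ_)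
open import Data.Nat.Combinatorics using (_C_; nC1≡n; nCk+nC[k+1]≡[n+1]C[k+1])
open import Data.Nat.DivMod using (_/_; +-distrib-/-∣ˡ)
open import Data.Nat.Divisibility using (divides)
import Data.Nat.Properties as ℕₚ
open import Data.Product using (Σ; ∃; _×_; _,_; proj₁; proj₂)
open import Data.Sum using (_⊎_; inj₁; inj₂)
open import Data.Unit using (⊤; tt)
open import Function using (_∘_)
open import Relation.Binary.PropositionalEquality
open import Relation.Nullary using (¬_; Dec; yes; no; does)
open import Relation.Nullary.Decidable using (toWitness; _⊎-dec_; _→-dec_; _×-dec_)

-- Finite graphs, induced subgraphs and colourings

record FinGraph : Set₁ where
  infix 7 _~_
  field
    V        : Set
    _~_      : V → V → Bool
    ~-sym    : ∀ u v → u ~ v ≡ v ~ u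
    ~-irrefl : ∀ v → v ~ v ≡ false
    vertices : List V
    complete : ∀ v → v ∈ vertices

  exists? : {P : V → Set} → (∀ v → Dec (P v)) → Dec (∃ P)
  exists? P? with any? P? vertices
  ... | yes p = yes (satisfied p)
  ... | no ¬p = no λ (v , p) → ¬p (lose (complete v) p)

  -- Here `A` is an outcome that settles the whole graph at once, such as a finished colouring or a
  -- pentagon, and `B v` is local data at `v`. One vertex with the global outcome suffices; failing
  -- that, the local data can be collected.
  choice : {A : Set} {B : V → Set} → (∀ v → A ⊎ B v) → A ⊎ (∀ v → B v)
  choice {A} {B} h with exists? {λ v → ∃ λ a → h v ≡ inj₁ a} left?
    where
    left? : ∀ v → Dec (∃ λ a → h v ≡ inj₁ a)
    left? v with h v
    ... | inj₁ a = yes (a , refl)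
    ... | inj₂ b = no λ ()
  ... | yes (_ , a , _) = inj₁ a
  ... | no none = inj₂ right
    where
    right : ∀ v → B v
    right v with h v in eq
    ... | inj₁ a = ⊥-elim (none (v , a , eq))
    ... | inj₂ b = b

open FinGraph

sub : (G : FinGraph) → (V G → Bool) → FinGraph
sub G S = record
  { V        = W
  ; _~_      = λ u v → _~_ G (proj₁ u) (proj₁ v)
  ; ~-sym    = λ u v → ~-sym G _ _
  ; ~-irrefl = λ v → ~-irrefl G _
  ; vertices = concatMap restrict (vertices G)
  ; complete = λ (v , p) → ∈-concatMap⁺ restrict (lose (complete G v) (restricted v p)) }
  where
  W = ∃ λ v → S v ≡ true
  restrict : V G → List W
  restrict v with S v Boolₚ.≟ true
  ... | yes p = (v , p) ∷ []
  ... | no _  = []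
  restricted : ∀ v p → (v , p) ∈ restrict v
  restricted v p with S v Boolₚ.≟ true
  ... | yes q = here (cong (v ,_) (Decidable⇒UIP.≡-irrelevant Boolₚ._≟_ p q))
  ... | no ¬q = ⊥-elim (¬q p)

Colouring : FinGraph → ℕ → Set
Colouring G m = Σ (V G → Fin m) λ c → ∀ u v → _~_ G u v ≡ true → c u ≢ c v

relax : ∀ {G a b} → a ≤ b → Colouring G a → Colouring G b
relax a≤b (c , proper) =
  (λ v → inject≤ (c v) a≤b) , λ u v e eq → proper u v e (Finₚ.inject≤-injective a≤b a≤b _ _ eq)

unnot : ∀ {b} → not b ≡ true → b ≡ false
unnot p = trans (sym (Boolₚ.not-involutive _)) (cong not p)

true≢false : ∀ {b} → b ≡ true → b ≡ false → ⊥
true≢false p q with trans (sym p) q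
... | ()

-- The two sides get disjoint palettes, so edges between them are never monochromatic.
glue : ∀ {a b} (G : FinGraph) (S : V G → Bool) →
  Colouring (sub G S) a → Colouring (sub G (not ∘ S)) b → Colouring G (a + b)
glue {a} {b} G S (c , c-proper) (d , d-proper) = colour , proper
  where
  pick : ∀ v (s : Bool) → S v ≡ s → Fin (a + b)
  pick v true  p = c (v , p) ↑ˡ b
  pick v false p = a ↑ʳ d (v , cong not p)
  colour : V G → Fin (a + b)
  colour v = pick v (S v) refl
  ↑ˡ≢↑ʳ : ∀ {x : Fin a} {y : Fin b} → x ↑ˡ b ≢ a ↑ʳ y
  ↑ˡ≢↑ʳ {x} {y} eq with trans (sym (Finₚ.splitAt-↑ˡ a x b)) (trans (cong (splitAt a) eq) (Finₚ.splitAt-↑ʳ a b y))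
  ... | ()
  separate : ∀ u v (s t : Bool) (p : S u ≡ s) (q : S v ≡ t) →
    _~_ G u v ≡ true → pick u s p ≢ pick v t q
  separate u v true  true  p q e eq = c-proper _ _ e (Finₚ.↑ˡ-injective b _ _ eq)
  separate u v false false p q e eq = d-proper _ _ e (Finₚ.↑ʳ-injective a _ _ eq)
  separate u v true  false p q e eq = ↑ˡ≢↑ʳ eq
  separate u v false true  p q e eq = ↑ˡ≢↑ʳ (sym eq)
  proper : ∀ u v → _~_ G u v ≡ true → colour u ≢ colour v
  proper u v = separate u v (S u) (S v) refl refl

monochrome : ∀ {G} → (∀ u v → _~_ G u v ≡ true → ⊥) → Colouring G 1
monochrome edgeless = (λ _ → zero) , λ u v e _ → edgeless u v e

-- Cliques

Clique : FinGraph → ℕ → Set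
Clique G k = Σ (Fin k → V G) λ q → ∀ i j → i ≢ j → _~_ G (q i) (q j) ≡ true

module _ (G : FinGraph) where
  private
    _≈_ = _~_ G

  ≈-sym : ∀ {u v b} → u ≈ v ≡ b → v ≈ u ≡ b
  ≈-sym e = trans (~-sym G _ _) e

  ∅ : Clique G 0
  ∅ = (λ ()) , λ ()

  extend : ∀ {k} (u : V G) (Q : Clique G k) → (∀ i → u ≈ proj₁ Q i ≡ true) → Clique G (suc k)
  extend u (q , clique) joined = q′ , clique′
    where
    q′ : Fin _ → V G
    q′ zero    = u
    q′ (suc i) = q i
    clique′ : ∀ i j → i ≢ j → q′ i ≈ q′ j ≡ true
    clique′ zero    zero    i≢j = ⊥-elim (i≢j refl)
    clique′ zero    (suc j) _   = joined j
    clique′ (suc i) zero    _   = ≈-sym (joined i)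
    clique′ (suc i) (suc j) i≢j = clique i j (i≢j ∘ cong suc)

  lift : ∀ {S k} → Clique (sub G S) k → Clique G k
  lift (q , clique) = proj₁ ∘ q , clique

  extend-sub : ∀ {S k} u → (∀ v → S v ≡ true → u ≈ v ≡ true) →
    Clique (sub G S) k → Clique G (suc k)
  extend-sub u joined Q = extend u (lift Q) λ i → joined _ (proj₂ (proj₁ Q i))

  edge-clique : ∀ {u v} → u ≈ v ≡ true → Clique G 2
  edge-clique {u} {v} e = extend u (extend v ∅ λ ()) λ { zero → e }

-- A clique of size `suc k` is a vertex `v` with a clique of size `k` in its neighbourhood, so the
-- search descends into neighbourhoods.
clique? : ∀ k G → Dec (Clique G k)
clique? zero    G = yes ((λ ()) , λ ())
clique? (suc k) G with exists? G (λ v → clique? k (sub G (_~_ G v)))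
... | yes (v , Q) = yes (extend-sub G v (λ _ p → p) Q)
... | no none     = no λ (q , clique) → none (q zero ,
        (λ i → q (suc i) , clique zero (suc i) λ ()) ,
        λ i j i≢j → clique (suc i) (suc j) (i≢j ∘ Finₚ.suc-injective))

edgeless : ∀ G → ¬ Clique G 2 → Colouring G 1
edgeless G ¬K₂ = monochrome {G} λ u v e → ¬K₂ (edge-clique G e)

no-vertices : ∀ G → ¬ Clique G 1 → ∀ {k} → Colouring G k
no-vertices G ¬K₁ = (λ v → ⊥-elim (¬K₁ (one v))) , λ u → ⊥-elim (¬K₁ (one u))
  where
  one : V G → Clique G 1
  one v = extend G v (∅ G) λ ()

-- Graphs without P₄ or P₄ ∪ K₁

module _ (G : FinGraph) where
  private
    _≈_ = _~_ G

  -- The six adjacencies force the four vertices apart: two of them are either adjacent or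
  -- distinguished by a third.
  record P₄ : Set where
    constructor p₄
    field
      {a b c d} : V G
      ab : a ≈ b ≡ true
      bc : b ≈ c ≡ true
      cd : c ≈ d ≡ true
      ac : a ≈ c ≡ false
      bd : b ≈ d ≡ false
      ad : a ≈ d ≡ false

  record P₄+K₁ : Set where
    constructor p₄+k₁
    field
      path : P₄
    open P₄ path public
    field
      {z} : V G
      za : z ≈ a ≡ false
      zb : z ≈ b ≡ false
      zc : z ≈ c ≡ false
      zd : z ≈ d ≡ false

lift-P₄ : ∀ {G S} → P₄ (sub G S) → P₄ G
lift-P₄ (p₄ ab bc cd ac bd ad) = p₄ ab bc cd ac bd ad

lift-P₄+K₁ : ∀ {G S} → P₄+K₁ (sub G S) → P₄+K₁ G
lift-P₄+K₁ (p₄+k₁ P {z , _} za zb zc zd) = p₄+k₁ (lift-P₄ P) {z} za zb zc zd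

module _ (G : FinGraph) where
  private
    _≈_ = _~_ G

  sees? : ∀ (I : List (V G)) v → Dec (Any (λ u → u ≈ v ≡ true) I)
  sees? I v = any? (λ u → u ≈ v Boolₚ.≟ true) I

  Independent : List (V G) → Set
  Independent I = ∀ {u v} → u ∈ I → v ∈ I → u ≈ v ≡ false

  greedy : ∀ vs → Σ (List (V G)) λ I → Independent I ×
    (∀ {v} → v ∈ vs → v ∈ I ⊎ Any (λ u → u ≈ v ≡ true) I)
  greedy [] = [] , (λ ()) , λ ()
  greedy (x ∷ vs) with greedy vs
  ... | I , independent , maximal with sees? I x
  ...   | yes seen = I , independent , λ { (here refl) → inj₂ seen ; (there m) → maximal m }
  ...   | no unseen = x ∷ I , independent′ , maximal′
    where
    apart : ∀ {u} → u ∈ I → u ≈ x ≡ false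
    apart m = Boolₚ.¬-not (unseen ∘ lose m)
    independent′ : Independent (x ∷ I)
    independent′ (here refl) (here refl) = ~-irrefl G x
    independent′ (here refl) (there n)   = ≈-sym G (apart n)
    independent′ (there m)   (here refl) = apart m
    independent′ (there m)   (there n)   = independent m n
    maximal′ : ∀ {v} → v ∈ x ∷ vs → v ∈ x ∷ I ⊎ Any (λ u → u ≈ v ≡ true) (x ∷ I)
    maximal′ (here refl) = inj₁ (here refl)
    maximal′ (there m) with maximal m
    ... | inj₁ p = inj₁ (there p)
    ... | inj₂ p = inj₂ (there p)

  -- An exchange argument: if u misses q₀ and the neighbour u′ of q₀ misses qᵢ, then u qᵢ q₀ u′ is a P₄.
  dominating : ¬ P₄ G → ∀ {I} → Independent I → ∀ {k} (Q : Clique G (suc k)) →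
    (∀ i → Any (λ u → u ≈ proj₁ Q i ≡ true) I) →
    ∃ λ u → u ∈ I × ∀ i → u ≈ proj₁ Q i ≡ true
  dominating ¬P₄ {I} independent {zero} (q , _) seen with find (seen zero)
  ... | u , u∈I , e = u , u∈I , λ { zero → e }
  dominating ¬P₄ {I} independent {suc k} (q , clique) seen
    with dominating ¬P₄ independent
           (q ∘ suc , λ i j i≢j → clique (suc i) (suc j) (i≢j ∘ Finₚ.suc-injective)) (seen ∘ suc)
  ... | u , u∈I , sees-tail with u ≈ q zero in uq₀
  ...   | true = u , u∈I , λ { zero → uq₀ ; (suc i) → sees-tail i }
  ...   | false with find (seen zero)
  ...     | u′ , u′∈I , u′q₀ = u′ , u′∈I , λ
    { zero    → u′q₀
    ; (suc i) → Boolₚ.¬-not (λ miss → ¬P₄ (p₄ (sees-tail i) (clique (suc i) zero λ ()) (≈-sym G u′q₀)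
                  uq₀ (≈-sym G miss) (independent u∈I u′∈I))) }

-- A maximal independent set takes one colour. A clique of size `suc k` avoiding it would, by
-- `dominating`, be completely joined to one of its vertices and so extend to a clique of size
-- `suc (suc k)`; hence deleting the set lowers the clique bound by one.
P₄-free-colouring : ∀ k G → ¬ P₄ G → ¬ Clique G (suc k) → Colouring G k
P₄-free-colouring zero    G ¬P₄ ¬K = no-vertices G ¬K
P₄-free-colouring (suc k) G ¬P₄ ¬K with greedy G (vertices G)
... | I , independent , maximal =
  glue G S (monochrome {sub G S} S-edgeless)
    (P₄-free-colouring k (sub G (not ∘ S)) (¬P₄ ∘ lift-P₄) λ Q →
      let u , _ , joined = dominating G ¬P₄ independent (lift G Q) (λ i → S-false (proj₂ (proj₁ Q i)))
      in ¬K (extend G u (lift G Q) joined))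
  where
  S : V G → Bool
  -- By independence and maximality, the vertices without a neighbour in `I` are exactly those of
  -- `I`; in this form membership is a Boolean test.
  S v = not (does (sees? G I v))
  S-true : ∀ {v} → S v ≡ true → ¬ Any (λ u → _~_ G u v ≡ true) I
  S-true {v} p with sees? G I v
  ... | no unseen = unseen
  S-false : ∀ {v} → not (S v) ≡ true → Any (λ u → _~_ G u v ≡ true) I
  S-false {v} p with sees? G I v
  ... | yes seen = seen
  S-edgeless : ∀ u v → _~_ (sub G S) u v ≡ true → ⊥
  S-edgeless (u , p) (v , q) e with maximal (complete G u)
  ... | inj₁ u∈I  = S-true q (lose u∈I e)
  ... | inj₂ seen = S-true p seen

C₂-step : ∀ n → n C 2 + n ≡ suc n C 2
C₂-step n = begin
  n C 2 + n      ≡⟨ cong (n C 2 +_) (nC1≡n n) ⟨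
  n C 2 + n C 1  ≡⟨ ℕₚ.+-comm (n C 2) (n C 1) ⟩
  n C 1 + n C 2  ≡⟨ nCk+nC[k+1]≡[n+1]C[k+1] n 1 ⟩
  suc n C 2      ∎
  where open ≡-Reasoning

-- A P₄ among the non-neighbours of `x` would form P₄ ∪ K₁ with `x`, so `suc k` colours suffice
-- there. The neighbours of `x` have a smaller clique bound, and Pascal's rule adds up the two
-- numbers.
P₄+K₁-free-colouring : ∀ k G → ¬ P₄+K₁ G → ¬ Clique G (suc k) → Colouring G (suc k C 2)
P₄+K₁-free-colouring zero    G ¬H ¬K = no-vertices G ¬K
P₄+K₁-free-colouring (suc k) G ¬H ¬K with exists? G {λ _ → ⊤} (λ _ → yes tt)
... | no none = (λ v → ⊥-elim (none (v , tt))) , λ u → ⊥-elim (none (u , tt))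
... | yes (x , _) =
  subst (Colouring G) (C₂-step (suc k))
    (glue G (_~_ G x)
      (P₄+K₁-free-colouring k _ (¬H ∘ lift-P₄+K₁) (¬K ∘ extend-sub G x (λ _ p → p)))
      (P₄-free-colouring (suc k) _ (λ P → ¬H (beside P)) (¬K ∘ lift G)))
  where
  beside : P₄ (sub G (not ∘ _~_ G x)) → P₄+K₁ G
  beside P@(p₄ {a , p} {b , q} {c , r} {d , s} _ _ _ _ _ _) =
    p₄+k₁ (lift-P₄ P) (unnot p) (unnot q) (unnot r) (unnot s)

-- Induced matchings and Wagon's bound for 2K₂-free graphs

far : (G : FinGraph) → V G → V G → FinGraph
far G u v = sub (sub G (not ∘ _~_ G u)) (not ∘ _~_ G v ∘ proj₁)

-- An induced matching with `p` edges: each edge lies among the common non-neighbours of the ends of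
-- the earlier ones. Induction on `p` thus passes from `G` to `far G u v`, which restricts in two
-- steps so that `glue` can treat one end at a time.
Matching : FinGraph → ℕ → Set
Matching G zero    = ⊤
Matching G (suc p) = Σ (V G) λ u → Σ (V G) λ v → _~_ G u v ≡ true × Matching (far G u v) p

beside-edge : ∀ G {u v x y} → _~_ G u v ≡ true → _~_ G x y ≡ true →
  _~_ G u x ≡ false → _~_ G v x ≡ false → _~_ G u y ≡ false → _~_ G v y ≡ false → Matching G 2
beside-edge G uv xy ux vx uy vy =
  _ , _ , uv , ((_ , cong not ux) , cong not vx) , ((_ , cong not uy) , cong not vy) , xy , tt

-- Wagon's argument: the vertices missing x and some other vertex of a maximum clique through x are independent.
module _ (G : FinGraph) (¬2K₂ : ¬ Matching G 2) (x : V G) where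
  private
    _≈_ = _~_ G

  -- The recursion removes one clique vertex at a time, and `φ` places the remaining graph `H` in
  -- `G`. Vertices of `H` missing `q zero` form one class, since an edge among them and the edge
  -- from `x` to `q zero` would be a 2K₂. The vertices left at the end see every `q i`, and by the
  -- last hypothesis they share one colour.
  colour-missing : ∀ {k} (q : Fin k → V G) → (∀ i → x ≈ q i ≡ true) →
    (H : FinGraph) (φ : V H → V G) → (∀ y z → _~_ H y z ≡ φ y ≈ φ z) →
    (∀ y → x ≈ φ y ≡ false) →
    (∀ y z → φ y ≈ φ z ≡ true → (∀ i → q i ≈ φ y ≡ true) → (∀ i → q i ≈ φ z ≡ true) → ⊥) →
    Colouring H (suc k)
  colour-missing {zero} q joined H φ φ-adj missed none =
    monochrome {H} λ y z e → none y z (trans (sym (φ-adj y z)) e) (λ ()) (λ ())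
  colour-missing {suc k} q joined H φ φ-adj missed none =
    subst (Colouring H) (ℕₚ.+-comm (suc k) 1)
      (glue H (_≈_ (q zero) ∘ φ)
        (colour-missing (q ∘ suc) (joined ∘ suc) (sub H (_≈_ (q zero) ∘ φ))
          (φ ∘ proj₁) (λ y z → φ-adj _ _) (missed ∘ proj₁)
          λ y z e ys zs → none _ _ e
            (λ { zero → proj₂ y ; (suc i) → ys i }) (λ { zero → proj₂ z ; (suc i) → zs i }))
        (monochrome {sub H (not ∘ _≈_ (q zero) ∘ φ)} λ (y , p) (z , r) e →
          ¬2K₂ (beside-edge G (joined zero) (trans (sym (φ-adj y z)) e)
            (missed y) (unnot p) (missed z) (unnot r))))

-- If there is a clique of size `suc k`, the neighbours of `q zero` have clique bound `k`. The other
-- vertices fall into `k` classes, according to a further clique vertex that they miss, and one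
-- class seeing all `k` of these; an edge in the last class would complete a clique of size
-- `suc (suc k)`.
wagon : ∀ k G → ¬ Matching G 2 → ¬ Clique G (suc k) → Colouring G (suc k C 2)
wagon zero    G ¬2K₂ ¬K = no-vertices G ¬K
wagon (suc k) G ¬2K₂ ¬K with clique? (suc k) G
... | no ¬K′ = relax {G} (subst (suc k C 2 ≤_) (C₂-step (suc k)) (ℕₚ.m≤m+n _ _)) (wagon k G ¬2K₂ ¬K′)
... | yes (q , clique) =
  subst (Colouring G) (C₂-step (suc k))
    (glue G (_~_ G (q zero))
      (wagon k (sub G (_~_ G (q zero))) (λ { (u , v , uv , (((x , _) , ux) , vx) , (((y , _) , uy) , vy) , xy , _) →
          ¬2K₂ (beside-edge G uv xy (unnot ux) (unnot vx) (unnot uy) (unnot vy)) })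
        (¬K ∘ extend-sub G (q zero) (λ _ p → p)))
      (colour-missing G ¬2K₂ (q zero) (q ∘ suc) (λ i → clique zero (suc i) λ ())
        (sub G (not ∘ _~_ G (q zero))) proj₁ (λ _ _ → refl) (unnot ∘ proj₂)
        λ y z e ys zs → ¬K (extend G (proj₁ y)
          (extend G (proj₁ z) (q ∘ suc , λ i j i≢j → clique (suc i) (suc j) (i≢j ∘ Finₚ.suc-injective))
            (≈-sym G ∘ zs))
          λ { zero → e ; (suc i) → ≈-sym G (ys i) })))

matching? : ∀ p G → Dec (Matching G p)
matching? zero    G = yes tt
matching? (suc p) G = exists? G λ u → exists? G λ v → (_~_ G u v Boolₚ.≟ true) ×-dec matching? p (far G u v)

-- A gem⁺ with centre `u` is a P₄ ∪ K₁ inside the neighbourhood of `u`.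
Gem⁺-free : FinGraph → Set
Gem⁺-free G = ∀ u → ¬ P₄+K₁ (sub G (_~_ G u))

-- Patterns and refutations

Fact : Set
Fact = ℕ × ℕ × Bool

Pattern : Set
Pattern = List Fact

same : Bool → Bool → Bool
same true  b = b
same false b = not b

states : Fact → Fact → Bool
states (i , j , b) (k , l , c) =
  same b c ∧ ((i ≡ᵇ k) ∧ (j ≡ᵇ l) ∨ (i ≡ᵇ l) ∧ (j ≡ᵇ k))

entails : Pattern → Fact → Bool
entails Γ φ = any (states φ) Γ

-- Every pair gets a fact, so the pattern describes an induced subgraph. Edges are given with the
-- smaller name first, and the facts come in the order 01, 02, 12, 03, ..., which the matches on
-- them below follow.
pattern-of : ℕ → List (ℕ × ℕ) → Pattern
pattern-of n E = concatMap (λ j → map (λ i → i , j , any (joins i j) E) (upTo j)) (upTo n)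
  where
  joins : ℕ → ℕ → ℕ × ℕ → Bool
  joins i j (k , l) = (i ≡ᵇ k) ∧ (j ≡ᵇ l)

-- `use m π` points at an occurrence, through the renaming π, of the m-th pattern known to be closed;
-- `split i j` distinguishes whether i and j are adjacent.
data Refutation : Set where
  use   : ℕ → List ℕ → Refutation
  split : ℕ → ℕ → Refutation → Refutation → Refutation

nth : {A : Set} → A → List A → ℕ → A
nth d []       _       = d
nth d (x ∷ xs) zero    = x
nth d (x ∷ xs) (suc i) = nth d xs i

contains : Pattern → List ℕ → Pattern → Bool
contains Γ π P = all (λ (i , j , b) → entails Γ (nth 0 π i , nth 0 π j , b)) P

-- Every branch must end in a known closed pattern, so `Γ` is refuted only up to graphs that are
-- already known to be 4-colourable.
refutes : List Pattern → Pattern → Refutation → Bool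
refutes []       Γ (use _ π)       = false
refutes (P ∷ Ps) Γ (use zero π)    = contains Γ π P
refutes (P ∷ Ps) Γ (use (suc m) π) = refutes Ps Γ (use m π)
refutes Ps       Γ (split i j r s) = refutes Ps ((i , j , true) ∷ Γ) r ∧ refutes Ps ((i , j , false) ∷ Γ) s

∧-true : ∀ {a b} → a ∧ b ≡ true → a ≡ true × b ≡ true
∧-true {true} {true} _ = refl , refl

∨-true : ∀ {a b} → a ∨ b ≡ true → a ≡ true ⊎ b ≡ true
∨-true {true}  _ = inj₁ refl
∨-true {false} p = inj₂ p

≡ᵇ-true : ∀ {m n} → (m ≡ᵇ n) ≡ true → m ≡ n
≡ᵇ-true {m} {n} p = ℕₚ.≡ᵇ⇒≡ m n (subst T (sym p) tt)

same-true : ∀ b c → same b c ≡ true → b ≡ c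
same-true true  true  _ = refl
same-true false false _ = refl

all-true : ∀ {A : Set} (p : A → Bool) xs → all p xs ≡ true → All (λ x → p x ≡ true) xs
all-true p []       _ = []
all-true p (x ∷ xs) h = let px , pxs = ∧-true h in px ∷ all-true p xs pxs

-- Facts of this kind survive when the names from `n` on are given to new vertices.
below : ℕ → Fact → Bool
below n (i , j , _) = (i <ᵇ n) ∧ (j <ᵇ n)

-- Colouring schemes and their conflicts

-- A decision tree that colours a vertex by its adjacency to the vertices named 0, …, n - 1 of a pattern.
data Scheme : Set where
  colour  : Fin 4 → Scheme
  refuted : Refutation → Scheme
  ask     : ℕ → Scheme → Scheme → Scheme

Path : Set
Path = List (ℕ × Bool)

Leaf : Set
Leaf = Fin 4 × Path

leaves : Path → Scheme → List Leaf
leaves path (colour c)  = (c , path) ∷ []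
leaves path (refuted r) = []
leaves path (ask j s t) = leaves ((j , true) ∷ path) s ++ leaves ((j , false) ∷ path) t

at : ℕ → Path → Pattern
at n = map λ (j , b) → n , j , b

-- The vertex to be coloured is named n + 0, and a second one of the same colour n + 1.
module Check (Ps : List Pattern) (n : ℕ) (P : Pattern) where

  covers : Path → Scheme → Bool
  covers path (colour c)  = true
  covers path (refuted r) = refutes Ps (at (n + 0) path ++ P) r
  covers path (ask j s t) = (j <ᵇ n) ∧ covers ((j , true) ∷ path) s ∧ covers ((j , false) ∷ path) t

  conflict : Leaf → Leaf → Pattern
  conflict (_ , p) (_ , q) = (n + 0 , n + 1 , true) ∷ at (n + 0) p ++ at (n + 1) q ++ P

  against : Leaf → List Leaf → List Pattern
  against l []       = []
  against l (m ∷ ms) with proj₁ l Fin.≟ proj₁ m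
  ... | yes _ = conflict l m ∷ against l ms
  ... | no _  = against l ms

  conflicts : List Leaf → List Pattern
  conflicts []       = []
  -- `l` is compared with itself as well, since two adjacent vertices may reach the same leaf.
  conflicts (l ∷ ls) = against l (l ∷ ls) ++ conflicts ls

  refutes-all : List Pattern → List Refutation → Bool
  refutes-all []       _        = true
  refutes-all (Γ ∷ Γs) []       = false
  refutes-all (Γ ∷ Γs) (r ∷ rs) = refutes Ps Γ r ∧ refutes-all Γs rs

  colours : Scheme → List Refutation → Bool
  colours s rs = all (below n) P ∧ covers [] s ∧ refutes-all (conflicts (leaves [] s)) rs

  ∈-against : ∀ {l m} ms → m ∈ ms → proj₁ l ≡ proj₁ m → conflict l m ∈ against l ms
  ∈-against {l} (m ∷ ms) (here refl) eq with proj₁ l Fin.≟ proj₁ m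
  ... | yes _ = here refl
  ... | no ne = ⊥-elim (ne eq)
  ∈-against {l} (m ∷ ms) (there k) eq with proj₁ l Fin.≟ proj₁ m
  ... | yes _ = there (∈-against ms k eq)
  ... | no _  = ∈-against ms k eq

  -- Each unordered pair of leaves is listed in one orientation only, hence the alternative.
  ∈-conflicts : ∀ {l m ls} → l ∈ ls → m ∈ ls → proj₁ l ≡ proj₁ m →
    conflict l m ∈ conflicts ls ⊎ conflict m l ∈ conflicts ls
  ∈-conflicts {ls = ls} (here refl) k eq = inj₁ (∈-++⁺ˡ (∈-against ls k eq))
  ∈-conflicts {ls = ls} k (here refl) eq = inj₂ (∈-++⁺ˡ (∈-against ls k (sym eq)))
  ∈-conflicts {ls = l ∷ ls} (there k) (there k′) eq with ∈-conflicts k k′ eq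
  ... | inj₁ c = inj₁ (∈-++⁺ʳ (against l (l ∷ ls)) c)
  ... | inj₂ c = inj₂ (∈-++⁺ʳ (against l (l ∷ ls)) c)

splice : {A : Set} → ℕ → (ℕ → A) → (ℕ → A) → ℕ → A
splice zero    ρ σ i       = σ i
splice (suc n) ρ σ zero    = ρ zero
splice (suc n) ρ σ (suc i) = splice n (ρ ∘ suc) σ i

splice-old : ∀ {A : Set} n (ρ σ : ℕ → A) i → (i <ᵇ n) ≡ true → splice n ρ σ i ≡ ρ i
splice-old (suc n) ρ σ zero    _ = refl
splice-old (suc n) ρ σ (suc i) p = splice-old n (ρ ∘ suc) σ i p

splice-new : ∀ {A : Set} n (ρ σ : ℕ → A) k → splice n ρ σ (n + k) ≡ σ k
splice-new zero    ρ σ k = refl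
splice-new (suc n) ρ σ k = splice-new n (ρ ∘ suc) σ k

-- Soundness of refutations and schemes

module Semantics (G : FinGraph) where
  private
    _≈_ = _~_ G

  along : ∀ {x x′ y y′ b} → x′ ≡ x → y′ ≡ y → x ≈ y ≡ b → x′ ≈ y′ ≡ b
  along refl refl e = e

  Assignment : Set
  Assignment = ℕ → V G

  _⊨_ : Assignment → Fact → Set
  ρ ⊨ (i , j , b) = ρ i ≈ ρ j ≡ b

  -- Forbidden subgraphs are closed vacuously.
  Closed : Pattern → Set
  Closed P = ∀ ρ → All (ρ ⊨_) P → Colouring G 4

  states-sound : ∀ {ρ} φ ψ → states φ ψ ≡ true → ρ ⊨ ψ → ρ ⊨ φ
  states-sound (i , j , b) (k , l , c) h f with ∧-true {same b c} h
  ... | bc , h′ with same-true b c bc | ∨-true {(i ≡ᵇ k) ∧ (j ≡ᵇ l)} h′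
  ...   | refl | inj₁ e with ∧-true {i ≡ᵇ k} e
  ...     | ik , jl with ≡ᵇ-true {i} ik | ≡ᵇ-true {j} jl
  ...       | refl | refl = f
  states-sound (i , j , b) (k , l , c) h f | bc , h′ | refl | inj₂ e with ∧-true {i ≡ᵇ l} e
  ...     | il , jk with ≡ᵇ-true {i} il | ≡ᵇ-true {j} jk
  ...       | refl | refl = ≈-sym G f

  entails-sound : ∀ {ρ} Γ φ → entails Γ φ ≡ true → All (ρ ⊨_) Γ → ρ ⊨ φ
  entails-sound (ψ ∷ Γ) φ h (f ∷ fs) with ∨-true {states φ ψ} h
  ... | inj₁ h′ = states-sound φ ψ h′ f
  ... | inj₂ h′ = entails-sound Γ φ h′ fs

  contains-sound : ∀ {ρ} Γ π P → contains Γ π P ≡ true → All (ρ ⊨_) Γ → All ((ρ ∘ nth 0 π) ⊨_) P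
  contains-sound Γ π P h fs = All.map (λ e → entails-sound Γ _ e fs) (all-true _ P h)

  -- The actual adjacency of `ρ i` and `ρ j` selects a branch at each `split`. At a `use`, the
  -- assignment `ρ` composed with the renaming is an occurrence of a closed pattern, whose
  -- 4-colouring is returned.
  refutes-sound : ∀ {Ps} → All Closed Ps → ∀ Γ r → refutes Ps Γ r ≡ true → Closed Γ
  refutes-sound {P ∷ Ps} (c ∷ cs) Γ (use zero π)    h ρ fs = c _ (contains-sound Γ π P h fs)
  refutes-sound {P ∷ Ps} (c ∷ cs) Γ (use (suc m) π) h ρ fs = refutes-sound cs Γ (use m π) h ρ fs
  refutes-sound {Ps} cs Γ (split i j r s) h ρ fs with ∧-true {refutes Ps _ r} (split-eq Ps h) | ρ i ≈ ρ j in eq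
    where
    split-eq : ∀ Ps → refutes Ps Γ (split i j r s) ≡ true →
      refutes Ps ((i , j , true) ∷ Γ) r ∧ refutes Ps ((i , j , false) ∷ Γ) s ≡ true
    split-eq []      h = h
    split-eq (_ ∷ _) h = h
  ... | hr , hs | true  = refutes-sound cs _ r hr ρ (eq ∷ fs)
  ... | hr , hs | false = refutes-sound cs _ s hs ρ (eq ∷ fs)

  splice-⊨ : ∀ n {ρ σ P} → all (below n) P ≡ true → All (ρ ⊨_) P → All (splice n ρ σ ⊨_) P
  splice-⊨ n {ρ} {σ} {P} h fs = All.zipWith step (all-true (below n) P h , fs)
    where
    step : ∀ {φ} → below n φ ≡ true × ρ ⊨ φ → splice n ρ σ ⊨ φ
    step {i , j , b} (lt , f) with ∧-true {i <ᵇ n} lt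
    ... | i<n , j<n rewrite splice-old n ρ σ i i<n | splice-old n ρ σ j j<n = f

  module _ {Ps : List Pattern} (closed : All Closed Ps) (n : ℕ) (P : Pattern) where
    open Check Ps n P

    Fits : Assignment → V G → Path → Set
    Fits ρ v = All λ (j , b) → (j <ᵇ n) ≡ true × v ≈ ρ j ≡ b

    at-sound : ∀ {ρ σ v} k path → σ k ≡ v → Fits ρ v path → All (splice n ρ σ ⊨_) (at (n + k) path)
    at-sound k [] eq [] = []
    at-sound {ρ} {σ} k ((j , b) ∷ path) refl ((j<n , f) ∷ fs) = g ∷ at-sound k path refl fs
      where
      g : splice n ρ σ (n + k) ≈ splice n ρ σ j ≡ b
      g rewrite splice-new n ρ σ k | splice-old n ρ σ j j<n = f

    refutes-all-sound : ∀ Γs rs → refutes-all Γs rs ≡ true → All Closed Γs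
    refutes-all-sound []       rs       h = []
    refutes-all-sound (Γ ∷ Γs) (r ∷ rs) h with ∧-true {refutes Ps Γ r} h
    ... | hr , hrs = refutes-sound closed Γ r hr ∷ refutes-all-sound Γs rs hrs

    -- Each vertex is sent down the tree. A vertex at a `refuted` leaf, or two adjacent vertices
    -- with the same colour, give an occurrence of a closed pattern and hence a 4-colouring;
    -- otherwise the colours at the leaves are proper.
    colours-sound : ∀ s rs → colours s rs ≡ true → Closed P
    colours-sound s rs h ρ fs = result
      where
      P-below = proj₁ (∧-true {all (below n) P} h)
      covered = proj₁ (∧-true {covers [] s} (proj₂ (∧-true {all (below n) P} h)))
      refuted-conflicts = refutes-all-sound (conflicts (leaves [] s)) rs
        (proj₂ (∧-true {covers [] s} (proj₂ (∧-true {all (below n) P} h))))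

      classify : ∀ v path s → covers path s ≡ true → Fits ρ v path →
        Colouring G 4 ⊎ ∃ λ l → l ∈ leaves path s × Fits ρ v (proj₂ l)
      classify v path (colour c)  h fits = inj₂ (_ , here refl , fits)
      classify v path (refuted r) h fits =
        inj₁ (refutes-sound closed _ r h (splice n ρ (λ _ → v))
          (Allₚ.++⁺ (at-sound 0 path refl fits) (splice-⊨ n P-below fs)))
      classify v path (ask j s t) h fits with ∧-true {j <ᵇ n} h | v ≈ ρ j in eq
      ... | j<n , hh | true with classify v _ s (proj₁ (∧-true {covers _ s} hh)) ((j<n , eq) ∷ fits)
      ...   | inj₁ q = inj₁ q
      ...   | inj₂ (l , l∈ , lfits) = inj₂ (l , ∈-++⁺ˡ l∈ , lfits)
      classify v path (ask j s t) h fits | j<n , hh | false with classify v _ t (proj₂ (∧-true {covers _ s} hh)) ((j<n , eq) ∷ fits)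
      ...   | inj₁ q = inj₁ q
      ...   | inj₂ (l , l∈ , lfits) = inj₂ (l , ∈-++⁺ʳ (leaves _ s) l∈ , lfits)

      clash : ∀ {u v l m} → u ≈ v ≡ true → Fits ρ u (proj₂ l) → Fits ρ v (proj₂ m) →
        conflict l m ∈ conflicts (leaves [] s) → Colouring G 4
      clash {u} {v} {l} {m} e us vs c = All.lookup refuted-conflicts c (splice n ρ σ)
        (uv ∷ Allₚ.++⁺ (at-sound 0 (proj₂ l) refl us) (Allₚ.++⁺ (at-sound 1 (proj₂ m) refl vs) (splice-⊨ n P-below fs)))
        where
        σ : Assignment
        σ zero    = u
        σ (suc _) = v
        uv : splice n ρ σ (n + 0) ≈ splice n ρ σ (n + 1) ≡ true
        uv rewrite splice-new n ρ σ 0 | splice-new n ρ σ 1 = e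

      result : Colouring G 4
      result with choice G (λ v → classify v [] s covered [])
      ... | inj₁ q = q
      ... | inj₂ leaf with choice G (λ u → choice G (λ v → distinct u v))
        where
        distinct : ∀ u v → Colouring G 4 ⊎ (u ≈ v ≡ true → proj₁ (proj₁ (leaf u)) ≢ proj₁ (proj₁ (leaf v)))
        distinct u v with u ≈ v in e | proj₁ (proj₁ (leaf u)) Fin.≟ proj₁ (proj₁ (leaf v))
        ... | false | _     = inj₂ λ ()
        ... | true  | no ne = inj₂ λ _ → ne
        ... | true  | yes eq with leaf u | leaf v
        ...   | l , l∈ , us | m , m∈ , vs with ∈-conflicts l∈ m∈ eq
        ...     | inj₁ c = inj₁ (clash {l = l} {m} e us vs c)
        ...     | inj₂ c = inj₁ (clash {l = m} {l} (≈-sym G e) vs us c)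
      ...   | inj₁ q = q
      ...   | inj₂ proper = (λ v → proj₁ (proj₁ (leaf v))) , proper

-- Pentagons in triangle-free, 2K₂-free graphs

triangle : ∀ G {x y z} → _~_ G x y ≡ true → _~_ G x z ≡ true → _~_ G y z ≡ true → Clique G 3
triangle G xy xz yz = extend G _ (edge-clique G yz) λ { zero → xy ; (suc zero) → xz }

-- With the edge `uv` these facts describe an induced 5-cycle u z y x v.
record Pentagon (G : FinGraph) (u v : V G) : Set where
  private
    _≈_ = _~_ G
  field
    {z x y} : V G
    uz : u ≈ z ≡ true
    vx : v ≈ x ≡ true
    zy : z ≈ y ≡ true
    xy : x ≈ y ≡ true
    vz : v ≈ z ≡ false
    ux : u ≈ x ≡ false
    zx : z ≈ x ≡ false
    uy : u ≈ y ≡ false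
    vy : v ≈ y ≡ false

module _ (G : FinGraph) (¬2K₂ : ¬ Matching G 2) (¬K₃ : ¬ Clique G 3)
         {u v : V G} (uv : _~_ G u v ≡ true) where
  private
    _≈_ = _~_ G
    Reached : V G → Set
    Reached w = ∃ λ z → u ≈ z ≡ true × z ≈ w ≡ true

  -- The index is the side of an attempted bipartition: the neighbours of `u` on one side, those of
  -- `v` outside them on the other. A vertex missing both is placed opposite to the neighbours of
  -- `u` if it has a neighbour there, and with them if not.
  data Kind (w : V G) : Fin 2 → Set where
    beside-u  : u ≈ w ≡ true → Kind w zero
    unreached : u ≈ w ≡ false → v ≈ w ≡ false → ¬ Reached w → Kind w zero
    beside-v  : u ≈ w ≡ false → v ≈ w ≡ true → Kind w (suc zero)
    reached   : u ≈ w ≡ false → v ≈ w ≡ false → Reached w → Kind w (suc zero)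

  kind : ∀ w → ∃ (Kind w)
  kind w with u ≈ w in uw | v ≈ w in vw
                | exists? G (λ z → (u ≈ z Boolₚ.≟ true) ×-dec (z ≈ w Boolₚ.≟ true))
  ... | true  | _     | _     = _ , beside-u uw
  ... | false | true  | _     = _ , beside-v uw vw
  ... | false | false | yes r = _ , reached uw vw r
  ... | false | false | no ¬r = _ , unreached uw vw ¬r

  remote : ∀ {w w′} → u ≈ w ≡ false → v ≈ w ≡ false → u ≈ w′ ≡ false → v ≈ w′ ≡ false →
    w ≈ w′ ≡ true → ⊥
  remote uw vw uw′ vw′ e = ¬2K₂ (beside-edge G uv e uw vw uw′ vw′)

  pentagon-via : ∀ {x y} → u ≈ x ≡ false → v ≈ x ≡ true →
    u ≈ y ≡ false → v ≈ y ≡ false → Reached y → x ≈ y ≡ true → Pentagon G u v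
  pentagon-via ux vx uy vy (z , uz , zy) xy = record
    { uz = uz ; vx = vx ; zy = zy ; xy = xy ; ux = ux ; uy = uy ; vy = vy
    ; vz = Boolₚ.¬-not λ vz → ¬K₃ (triangle G uv uz vz)
    ; zx = Boolₚ.¬-not λ zx → ¬K₃ (triangle G zx zy xy) }

  -- Most edges inside a side contradict the absence of triangles, the absence of 2K₂ or the choice
  -- of the side. What remains is an edge between a neighbour of `v` and a `reached` vertex, and it
  -- closes a pentagon.
  same-kind : ∀ {w w′ i} → Kind w i → Kind w′ i → w ≈ w′ ≡ true → Pentagon G u v
  same-kind (beside-u uw) (beside-u uw′) e = ⊥-elim (¬K₃ (triangle G uw uw′ e))
  same-kind (beside-u uw) (unreached _ _ ¬r) e = ⊥-elim (¬r (_ , uw , e))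
  same-kind (unreached _ _ ¬r) (beside-u uw′) e = ⊥-elim (¬r (_ , uw′ , ≈-sym G e))
  same-kind (unreached uw vw _) (unreached uw′ vw′ _) e = ⊥-elim (remote uw vw uw′ vw′ e)
  same-kind (beside-v _ vw) (beside-v _ vw′) e = ⊥-elim (¬K₃ (triangle G vw vw′ e))
  same-kind (beside-v uw vw) (reached uw′ vw′ r) e = pentagon-via uw vw uw′ vw′ r e
  same-kind (reached uw vw r) (beside-v uw′ vw′) e = pentagon-via uw′ vw′ uw vw r (≈-sym G e)
  same-kind (reached uw vw _) (reached uw′ vw′ _) e = ⊥-elim (remote uw vw uw′ vw′ e)

  pentagon-or-bipartite : Pentagon G u v ⊎ Colouring G 2
  pentagon-or-bipartite with choice G (λ w → choice G (separate w))
    where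
    separate : ∀ w w′ → Pentagon G u v ⊎ (w ≈ w′ ≡ true → proj₁ (kind w) ≢ proj₁ (kind w′))
    separate w w′ with w ≈ w′ in e | proj₁ (kind w) Fin.≟ proj₁ (kind w′)
    ... | false | _      = inj₂ λ ()
    ... | true  | no ne  = inj₂ λ _ → ne
    ... | true  | yes eq = inj₁ (same-kind (subst (Kind w) eq (proj₂ (kind w))) (proj₂ (kind w′)) e)
  ... | inj₁ P      = inj₁ P
  ... | inj₂ proper = inj₂ (proj₁ ∘ kind , proper)

-- The common non-neighbours of an edge ab form a 2K₂-free graph. If it is bipartite, then N(a), N(b) and its two
-- sides give a 4-colouring; otherwise every edge uv in it lies on a pentagon u z y x v.
pentagon-facts : (a b u v z x y : ℕ) → Pattern
pentagon-facts a b u v z x y =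
  (u , z , true)  ∷ (v , x , true)  ∷ (z , y , true)  ∷ (x , y , true)  ∷
  (v , z , false) ∷ (u , x , false) ∷ (z , x , false) ∷ (u , y , false) ∷ (v , y , false) ∷
  (a , z , false) ∷ (a , x , false) ∷ (a , y , false) ∷ (b , z , false) ∷ (b , x , false) ∷ (b , y , false) ∷ []

two-edges : (a b u v : ℕ) → Pattern
two-edges a b u v =
  (a , b , true) ∷ (u , v , true) ∷ (a , u , false) ∷ (a , v , false) ∷ (b , u , false) ∷ (b , v , false) ∷ []

-- The pattern must contain the induced 2K₂ with edges `ab` and `uv`. The new pentagon vertices z,
-- x, y are named `n`, `n + 1`, `n + 2`, and the refutation has to close every extension of `P` by
-- them.
grows : List Pattern → ℕ → Pattern → (a b u v : ℕ) → Refutation → Bool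
grows Ps n P a b u v r = all (below n) P ∧ all (below n) (two-edges a b u v) ∧ all (entails P) (two-edges a b u v) ∧
  refutes Ps (pentagon-facts a b u v (n + 0) (n + 1) (n + 2) ++ P) r

module _ (G : FinGraph) (¬3K₂ : ¬ Matching G 3) (¬K₃ : ¬ Clique G 3) where
  open Semantics G
  private
    _≈_ = _~_ G

  grows-sound : ∀ {Ps} → All Closed Ps → ∀ n P a b u v r → grows Ps n P a b u v r ≡ true → Closed P
  grows-sound {Ps} closed n P a b u v r h ρ fs
    with ∧-true {all (below n) P} h
  ... | P-below , h₁ with ∧-true {all (below n) (two-edges a b u v)} h₁
  ...   | abuv-below , h₂ with ∧-true {all (entails P) (two-edges a b u v)} h₂
  ...     | entailed , h₃
    with All.map (λ {φ} e → entails-sound P φ e fs) (all-true (entails P) (two-edges a b u v) entailed)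
       | all-true (below n) (two-edges a b u v) abuv-below
  ...       | ab ∷ uv ∷ au ∷ av ∷ bu ∷ bv ∷ [] | ab< ∷ uv< ∷ _ = result
    where
    H = far G (ρ a) (ρ b)
    extended : ∀ (u′ v′ : V H) → proj₁ (proj₁ u′) ≡ ρ u → proj₁ (proj₁ v′) ≡ ρ v → Pentagon H u′ v′ → Colouring G 4
    extended ((_ , au) , bu) ((_ , av) , bv) refl refl
      record { z = (z , az) , bz ; x = (x , ax) , bx ; y = (y , ay) , by
             ; uz = uz ; vx = vx ; zy = zy ; xy = xy ; vz = vz ; ux = ux ; zx = zx ; uy = uy ; vy = vy } =
      refutes-sound closed _ r h₃ (splice n ρ σ) (Allₚ.++⁺ new (splice-⊨ n P-below fs))
      where
      σ : Assignment
      σ 0 = z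
      σ 1 = x
      σ _ = y
      new : All (splice n ρ σ ⊨_) (pentagon-facts a b u v (n + 0) (n + 1) (n + 2))
      new = let a< , b< = ∧-true {a <ᵇ n} ab< ; u< , v< = ∧-true {u <ᵇ n} uv<
                A = splice-old n ρ σ a a< ; B = splice-old n ρ σ b b<
                U = splice-old n ρ σ u u< ; W = splice-old n ρ σ v v<
                Z = splice-new n ρ σ 0 ; X = splice-new n ρ σ 1 ; Y = splice-new n ρ σ 2
            in along U Z uz ∷ along W X vx ∷ along Z Y zy ∷ along X Y xy ∷
               along W Z vz ∷ along U X ux ∷ along Z X zx ∷ along U Y uy ∷ along W Y vy ∷
               along A Z (unnot az) ∷ along A X (unnot ax) ∷ along A Y (unnot ay) ∷
               along B Z (unnot bz) ∷ along B X (unnot bx) ∷ along B Y (unnot by) ∷ []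
    result : Colouring G 4
    -- `H` has no 2K₂, because two such edges together with `ab` would be a 3K₂.
    result with pentagon-or-bipartite H (λ M → ¬3K₂ (_ , _ , ab , M)) (¬K₃ ∘ lift G ∘ lift (sub G (not ∘ _≈_ (ρ a))))
                  {(ρ u , cong not au) , cong not bu} {(ρ v , cong not av) , cong not bv} uv
    ... | inj₁ C = extended _ _ refl refl C
    ... | inj₂ χ = glue G (_≈_ (ρ a))
          (edgeless (sub G (_≈_ (ρ a))) (¬K₃ ∘ extend-sub G (ρ a) (λ _ p → p)))
          (glue (sub G (not ∘ _≈_ (ρ a))) (_≈_ (ρ b) ∘ proj₁)
            (edgeless (sub (sub G (not ∘ _≈_ (ρ a))) (_≈_ (ρ b) ∘ proj₁))
              (λ Q → ¬K₃ (extend G (ρ b) (lift G (lift (sub G (not ∘ _≈_ (ρ a))) Q)) (proj₂ ∘ proj₁ Q))))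
            χ)

-- {2K₂, K₄, gem⁺}-free graphs are 4-colourable

2K₂ K₄ gem⁺-pattern : Pattern
2K₂ = pattern-of 4 ((0 , 1) ∷ (2 , 3) ∷ [])
K₄ = pattern-of 4 ((0 , 1) ∷ (0 , 2) ∷ (1 , 2) ∷ (0 , 3) ∷ (1 , 3) ∷ (2 , 3) ∷ [])
gem⁺-pattern = pattern-of 6
  ((0 , 1) ∷ (1 , 2) ∷ (2 , 3) ∷ (0 , 4) ∷ (1 , 4) ∷ (2 , 4) ∷ (3 , 4) ∷ (4 , 5) ∷ [])

-- X₁, X₂ and X₃ extend the gem X₄ by one vertex; X₅ is the triangle. The decision trees were found by computer.
X₁ X₂ X₃ X₄ X₅ : Pattern
X₁ = pattern-of 6
  ((0 , 4) ∷ (1 , 3) ∷ (1 , 5) ∷ (2 , 4) ∷ (2 , 5) ∷ (3 , 4) ∷ (3 , 5) ∷ (4 , 5) ∷ [])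

X₂ = pattern-of 6
  ((0 , 3) ∷ (0 , 4) ∷ (1 , 2) ∷ (1 , 3) ∷ (1 , 5) ∷ (2 , 4) ∷ (2 , 5) ∷ (3 , 4) ∷ (3 , 5) ∷ (4 , 5) ∷ [])

X₃ = pattern-of 6
  ((0 , 1) ∷ (0 , 2) ∷ (0 , 4) ∷ (1 , 3) ∷ (1 , 5) ∷ (2 , 4) ∷ (2 , 5) ∷ (3 , 4) ∷ (3 , 5) ∷ (4 , 5) ∷ [])

X₄ = pattern-of 5
  ((0 , 1) ∷ (0 , 4) ∷ (1 , 2) ∷ (1 , 4) ∷ (2 , 3) ∷ (2 , 4) ∷ (3 , 4) ∷ [])

X₅ = pattern-of 3
  ((0 , 1) ∷ (0 , 2) ∷ (1 , 2) ∷ [])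

module _ (G : FinGraph) (¬2K₂ : ¬ Matching G 2) (gem⁺-free : Gem⁺-free G) (¬K₄ : ¬ Clique G 4) where
  open Semantics G

  private
    closed₀ : All Closed (gem⁺-pattern ∷ K₄ ∷ 2K₂ ∷ [])
    closed₀ =
      -- a, b, c, d are the path, h is the centre and z the pendant vertex.
      (λ { ρ (ab ∷ ac ∷ bc ∷ ad ∷ bd ∷ cd ∷ ah ∷ bh ∷ ch ∷ dh ∷ az ∷ bz ∷ cz ∷ dz ∷ hz ∷ []) →
        ⊥-elim (gem⁺-free (ρ 4) (p₄+k₁
          (p₄ {a = ρ 0 , ≈-sym G ah} {ρ 1 , ≈-sym G bh} {ρ 2 , ≈-sym G ch} {ρ 3 , ≈-sym G dh} ab bc cd ac bd ad)
          {ρ 5 , hz} (≈-sym G az) (≈-sym G bz) (≈-sym G cz) (≈-sym G dz))) }) ∷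
      (λ { ρ (ab ∷ ac ∷ bc ∷ ad ∷ bd ∷ cd ∷ []) →
        ⊥-elim (¬K₄ (extend G (ρ 0) (triangle G bc bd cd) λ { 0F → ab ; 1F → ac ; 2F → ad })) }) ∷
      (λ { ρ (ab ∷ ac ∷ bc ∷ ad ∷ bd ∷ cd ∷ []) →
        ⊥-elim (¬2K₂ (beside-edge G ab cd ac bc ad bd)) }) ∷ []

    -- The tree asks for adjacencies to the vertices 0 to 5. The refutations follow the order of
    -- `conflicts`, with 6 and 7 the two adjacent vertices of equal colour. Known patterns are
    -- counted from the one closed last, so here 0 is gem⁺, 1 is K₄ and 2 is 2K₂.
    closed₁ : All Closed (X₁ ∷ gem⁺-pattern ∷ K₄ ∷ 2K₂ ∷ [])
    closed₁ = colours-sound closed₀ 6 X₁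
      (ask 3 (ask 1 (colour 2F) (ask 2 (ask 4 (colour 2F) (ask 5 (colour 1F) (colour 3F))) (colour 1F))) (ask 0
      (colour 3F) (ask 4 (colour 0F) (colour 3F))))
      (use 1 (1 ∷ 3 ∷ 6 ∷ 7 ∷ []) ∷ split 4 6 (use 1 (4 ∷ 6 ∷ 3 ∷ 7 ∷ [])) (split 0 6 (split 2 6 (split 5 7 (use
      1 (5 ∷ 7 ∷ 2 ∷ 4 ∷ [])) (split 0 7 (use 2 (0 ∷ 7 ∷ 1 ∷ 5 ∷ [])) (use 0 (2 ∷ 7 ∷ 3 ∷ 1 ∷ 6 ∷ 0 ∷ []))))
      (use 2 (2 ∷ 4 ∷ 6 ∷ 1 ∷ []))) (use 2 (0 ∷ 4 ∷ 6 ∷ 1 ∷ []))) ∷ use 1 (2 ∷ 4 ∷ 6 ∷ 7 ∷ []) ∷ use 1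
      (2 ∷ 5 ∷ 6 ∷ 7 ∷ []) ∷ split 5 7 (use 1 (5 ∷ 7 ∷ 3 ∷ 6 ∷ [])) (split 0 7 (use 2 (0 ∷ 7 ∷ 1 ∷ 5 ∷ []))
      (split 0 6 (use 0 (2 ∷ 5 ∷ 3 ∷ 7 ∷ 6 ∷ 0 ∷ [])) (split 4 7 (use 0 (7 ∷ 3 ∷ 5 ∷ 2 ∷ 4 ∷ 0 ∷ [])) (use 2
      (4 ∷ 0 ∷ 7 ∷ 6 ∷ []))))) ∷ use 2 (1 ∷ 5 ∷ 6 ∷ 7 ∷ []) ∷ split 0 6 (use 2 (0 ∷ 6 ∷ 1 ∷ 5 ∷ [])) (split 1 7
      (split 5 7 (split 2 7 (use 0 (6 ∷ 2 ∷ 5 ∷ 1 ∷ 7 ∷ 0 ∷ [])) (split 4 7 (use 0 (0 ∷ 4 ∷ 5 ∷ 1 ∷ 7 ∷ 6 ∷ []))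
      (use 2 (4 ∷ 2 ∷ 7 ∷ 1 ∷ [])))) (use 2 (5 ∷ 3 ∷ 7 ∷ 0 ∷ []))) (use 2 (1 ∷ 3 ∷ 7 ∷ 0 ∷ []))) ∷ split 0 6
      (use 2 (0 ∷ 6 ∷ 1 ∷ 5 ∷ [])) (use 2 (0 ∷ 4 ∷ 6 ∷ 7 ∷ [])) ∷ split 5 6 (split 4 6 (use 1
      (4 ∷ 6 ∷ 3 ∷ 5 ∷ [])) (split 4 7 (split 5 7 (use 1 (5 ∷ 7 ∷ 3 ∷ 4 ∷ [])) (split 0 7 (use 2
      (0 ∷ 7 ∷ 1 ∷ 5 ∷ [])) (use 0 (7 ∷ 3 ∷ 5 ∷ 2 ∷ 4 ∷ 0 ∷ [])))) (use 2 (4 ∷ 2 ∷ 7 ∷ 6 ∷ [])))) (split 0 6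
      (use 2 (0 ∷ 6 ∷ 1 ∷ 5 ∷ [])) (split 5 7 (split 4 7 (use 1 (4 ∷ 7 ∷ 3 ∷ 5 ∷ [])) (split 4 6 (use 0
      (6 ∷ 3 ∷ 5 ∷ 2 ∷ 4 ∷ 0 ∷ [])) (use 2 (4 ∷ 2 ∷ 6 ∷ 7 ∷ [])))) (use 2 (5 ∷ 1 ∷ 7 ∷ 6 ∷ [])))) ∷ split 1 6
      (split 5 6 (split 1 7 (split 5 7 (use 1 (5 ∷ 7 ∷ 1 ∷ 6 ∷ [])) (use 2 (5 ∷ 3 ∷ 7 ∷ 0 ∷ []))) (use 2
      (1 ∷ 3 ∷ 7 ∷ 0 ∷ []))) (use 2 (5 ∷ 3 ∷ 6 ∷ 0 ∷ []))) (use 2 (1 ∷ 3 ∷ 6 ∷ 0 ∷ [])) ∷ split 1 6 (split 4 6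
      (split 5 6 (split 2 6 (use 1 (2 ∷ 6 ∷ 4 ∷ 5 ∷ [])) (split 1 7 (use 2 (1 ∷ 7 ∷ 0 ∷ 4 ∷ [])) (split 2 7 (use
      2 (2 ∷ 7 ∷ 1 ∷ 3 ∷ [])) (split 5 7 (use 0 (7 ∷ 6 ∷ 1 ∷ 3 ∷ 5 ∷ 2 ∷ [])) (use 0
      (1 ∷ 5 ∷ 4 ∷ 0 ∷ 6 ∷ 7 ∷ [])))))) (use 2 (5 ∷ 3 ∷ 6 ∷ 0 ∷ []))) (use 2 (4 ∷ 3 ∷ 6 ∷ 7 ∷ []))) (use 2
      (1 ∷ 3 ∷ 6 ∷ 0 ∷ [])) ∷ split 5 6 (split 5 7 (use 1 (5 ∷ 7 ∷ 4 ∷ 6 ∷ [])) (use 0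
      (3 ∷ 5 ∷ 6 ∷ 7 ∷ 4 ∷ 0 ∷ []))) (split 5 7 (use 0 (3 ∷ 5 ∷ 7 ∷ 6 ∷ 4 ∷ 0 ∷ [])) (use 2
      (5 ∷ 3 ∷ 7 ∷ 6 ∷ []))) ∷ use 2 (0 ∷ 4 ∷ 6 ∷ 7 ∷ []) ∷ [])
      refl ∷ closed₀

    closed₂ : All Closed (X₂ ∷ X₁ ∷ gem⁺-pattern ∷ K₄ ∷ 2K₂ ∷ [])
    closed₂ = colours-sound closed₁ 6 X₂
      (ask 5 (ask 1 (colour 1F) (colour 0F)) (ask 0 (colour 3F) (ask 3 (colour 2F) (colour 3F))))
      (use 2 (1 ∷ 5 ∷ 6 ∷ 7 ∷ []) ∷ split 2 6 (split 4 6 (use 2 (4 ∷ 6 ∷ 2 ∷ 5 ∷ [])) (split 2 7 (use 2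
      (2 ∷ 7 ∷ 5 ∷ 6 ∷ [])) (split 0 7 (use 3 (0 ∷ 7 ∷ 1 ∷ 2 ∷ [])) (split 0 6 (use 0
      (0 ∷ 1 ∷ 7 ∷ 2 ∷ 6 ∷ 5 ∷ [])) (split 4 7 (use 0 (0 ∷ 1 ∷ 7 ∷ 2 ∷ 4 ∷ 5 ∷ [])) (use 3
      (4 ∷ 0 ∷ 7 ∷ 6 ∷ []))))))) (split 0 6 (use 3 (0 ∷ 6 ∷ 1 ∷ 2 ∷ [])) (split 3 6 (use 0
      (0 ∷ 2 ∷ 6 ∷ 1 ∷ 3 ∷ 5 ∷ [])) (split 4 6 (use 0 (0 ∷ 1 ∷ 6 ∷ 2 ∷ 4 ∷ 5 ∷ [])) (use 0
      (6 ∷ 0 ∷ 1 ∷ 4 ∷ 5 ∷ 3 ∷ []))))) ∷ split 1 6 (split 2 6 (split 1 7 (split 2 7 (use 2 (2 ∷ 7 ∷ 1 ∷ 6 ∷ []))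
      (use 3 (2 ∷ 5 ∷ 7 ∷ 0 ∷ []))) (use 3 (1 ∷ 5 ∷ 7 ∷ 0 ∷ []))) (use 3 (2 ∷ 5 ∷ 6 ∷ 0 ∷ []))) (use 3
      (1 ∷ 5 ∷ 6 ∷ 0 ∷ [])) ∷ split 1 6 (split 2 6 (split 3 6 (split 2 7 (use 3 (2 ∷ 7 ∷ 0 ∷ 3 ∷ [])) (split 1 7
      (use 0 (0 ∷ 5 ∷ 7 ∷ 2 ∷ 6 ∷ 1 ∷ [])) (use 1 (2 ∷ 1 ∷ 3 ∷ 0 ∷ 6 ∷ 7 ∷ [])))) (use 3 (3 ∷ 5 ∷ 6 ∷ 7 ∷ [])))
      (use 3 (2 ∷ 5 ∷ 6 ∷ 0 ∷ []))) (use 3 (1 ∷ 5 ∷ 6 ∷ 0 ∷ [])) ∷ split 1 6 (split 1 7 (use 2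
      (1 ∷ 7 ∷ 3 ∷ 6 ∷ [])) (use 1 (5 ∷ 1 ∷ 6 ∷ 7 ∷ 3 ∷ 0 ∷ []))) (split 1 7 (use 1
      (5 ∷ 1 ∷ 7 ∷ 6 ∷ 3 ∷ 0 ∷ [])) (use 3 (1 ∷ 5 ∷ 7 ∷ 6 ∷ []))) ∷ use 3 (0 ∷ 3 ∷ 6 ∷ 7 ∷ []) ∷ [])
      refl ∷ closed₁

    closed₃ : All Closed (X₃ ∷ X₂ ∷ X₁ ∷ gem⁺-pattern ∷ K₄ ∷ 2K₂ ∷ [])
    closed₃ = colours-sound closed₂ 6 X₃
      (ask 0 (ask 2 (colour 3F) (ask 1 (colour 2F) (colour 1F))) (ask 5 (colour 2F) (ask 1 (colour 0F) (colour
      3F))))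
      (use 3 (0 ∷ 2 ∷ 6 ∷ 7 ∷ []) ∷ split 4 6 (use 3 (4 ∷ 6 ∷ 0 ∷ 2 ∷ [])) (split 2 7 (split 3 7 (split 4 7 (use
      0 (1 ∷ 7 ∷ 2 ∷ 3 ∷ 5 ∷ 4 ∷ [])) (split 5 6 (split 1 6 (split 3 6 (use 3 (3 ∷ 6 ∷ 1 ∷ 5 ∷ [])) (use 0
      (3 ∷ 6 ∷ 0 ∷ 5 ∷ 4 ∷ 2 ∷ []))) (use 1 (1 ∷ 7 ∷ 4 ∷ 6 ∷ 0 ∷ 2 ∷ []))) (use 4 (5 ∷ 4 ∷ 6 ∷ 7 ∷ [])))) (use 4
      (3 ∷ 1 ∷ 7 ∷ 2 ∷ []))) (split 3 7 (use 4 (3 ∷ 7 ∷ 0 ∷ 2 ∷ [])) (split 4 7 (use 2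
      (0 ∷ 2 ∷ 5 ∷ 3 ∷ 4 ∷ 7 ∷ [])) (split 3 6 (split 5 6 (use 2 (3 ∷ 5 ∷ 2 ∷ 0 ∷ 6 ∷ 7 ∷ [])) (use 4
      (5 ∷ 4 ∷ 6 ∷ 7 ∷ []))) (use 4 (3 ∷ 4 ∷ 6 ∷ 7 ∷ [])))))) ∷ use 3 (0 ∷ 1 ∷ 6 ∷ 7 ∷ []) ∷ split 4 6 (split 3
      6 (use 0 (2 ∷ 3 ∷ 1 ∷ 4 ∷ 0 ∷ 6 ∷ [])) (split 5 6 (split 1 7 (use 3 (1 ∷ 7 ∷ 5 ∷ 6 ∷ [])) (split 4 7 (use
      3 (4 ∷ 7 ∷ 5 ∷ 6 ∷ [])) (split 2 7 (split 3 7 (use 0 (0 ∷ 3 ∷ 7 ∷ 1 ∷ 6 ∷ 5 ∷ [])) (use 4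
      (3 ∷ 1 ∷ 7 ∷ 2 ∷ []))) (use 1 (7 ∷ 2 ∷ 1 ∷ 4 ∷ 6 ∷ 0 ∷ []))))) (use 4 (5 ∷ 3 ∷ 6 ∷ 0 ∷ [])))) (use 4
      (4 ∷ 2 ∷ 6 ∷ 1 ∷ [])) ∷ split 4 6 (split 4 7 (use 3 (4 ∷ 7 ∷ 0 ∷ 6 ∷ [])) (use 2
      (2 ∷ 4 ∷ 6 ∷ 7 ∷ 0 ∷ 1 ∷ []))) (split 4 7 (use 2 (2 ∷ 4 ∷ 7 ∷ 6 ∷ 0 ∷ 1 ∷ [])) (use 4
      (4 ∷ 2 ∷ 7 ∷ 6 ∷ []))) ∷ split 2 6 (split 4 6 (use 3 (4 ∷ 6 ∷ 2 ∷ 5 ∷ [])) (split 2 7 (use 3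
      (2 ∷ 7 ∷ 5 ∷ 6 ∷ [])) (split 4 7 (use 0 (0 ∷ 7 ∷ 6 ∷ 4 ∷ 2 ∷ 5 ∷ [])) (use 4 (4 ∷ 0 ∷ 7 ∷ 6 ∷ [])))))
      (split 2 7 (split 4 7 (use 3 (4 ∷ 7 ∷ 2 ∷ 5 ∷ [])) (split 4 6 (use 0 (0 ∷ 6 ∷ 7 ∷ 4 ∷ 2 ∷ 5 ∷ [])) (use 4
      (4 ∷ 0 ∷ 6 ∷ 7 ∷ [])))) (use 4 (2 ∷ 0 ∷ 7 ∷ 6 ∷ []))) ∷ split 3 6 (split 3 7 (use 3 (3 ∷ 7 ∷ 1 ∷ 6 ∷ []))
      (use 2 (5 ∷ 3 ∷ 6 ∷ 7 ∷ 1 ∷ 0 ∷ []))) (split 3 7 (use 2 (5 ∷ 3 ∷ 7 ∷ 6 ∷ 1 ∷ 0 ∷ [])) (use 4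
      (3 ∷ 5 ∷ 7 ∷ 6 ∷ []))) ∷ use 4 (0 ∷ 1 ∷ 6 ∷ 7 ∷ []) ∷ [])
      refl ∷ closed₂

    closed₄ : All Closed (X₄ ∷ X₃ ∷ X₂ ∷ X₁ ∷ gem⁺-pattern ∷ K₄ ∷ 2K₂ ∷ [])
    closed₄ = colours-sound closed₃ 5 X₄
      (ask 4 (ask 1 (colour 1F) (ask 2 (colour 0F) (colour 3F))) (ask 0 (colour 2F) (colour 3F)))
      (use 4 (1 ∷ 4 ∷ 5 ∷ 6 ∷ []) ∷ use 4 (2 ∷ 4 ∷ 5 ∷ 6 ∷ []) ∷ use 5 (1 ∷ 2 ∷ 5 ∷ 6 ∷ []) ∷ split 0 5 (split 3
      5 (split 1 6 (split 2 6 (use 0 (6 ∷ 5 ∷ 2 ∷ 0 ∷ 1 ∷ 4 ∷ [])) (split 3 6 (use 0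
      (6 ∷ 1 ∷ 3 ∷ 0 ∷ 5 ∷ 4 ∷ [])) (use 2 (6 ∷ 3 ∷ 0 ∷ 2 ∷ 1 ∷ 4 ∷ [])))) (split 3 6 (use 5
      (3 ∷ 6 ∷ 0 ∷ 1 ∷ [])) (use 2 (6 ∷ 1 ∷ 3 ∷ 0 ∷ 5 ∷ 4 ∷ [])))) (use 5 (3 ∷ 2 ∷ 5 ∷ 0 ∷ []))) (split 3 5 (use
      5 (3 ∷ 5 ∷ 0 ∷ 1 ∷ [])) (use 3 (3 ∷ 2 ∷ 1 ∷ 0 ∷ 4 ∷ 5 ∷ []))) ∷ split 1 5 (split 1 6 (use 4
      (1 ∷ 6 ∷ 0 ∷ 5 ∷ [])) (split 2 5 (split 3 5 (split 2 6 (split 3 6 (use 4 (3 ∷ 6 ∷ 2 ∷ 5 ∷ [])) (use 0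
      (4 ∷ 0 ∷ 3 ∷ 6 ∷ 2 ∷ 5 ∷ []))) (use 1 (6 ∷ 2 ∷ 4 ∷ 5 ∷ 0 ∷ 1 ∷ []))) (use 1 (3 ∷ 5 ∷ 0 ∷ 2 ∷ 4 ∷ 1 ∷ [])))
      (split 3 5 (use 0 (3 ∷ 5 ∷ 2 ∷ 0 ∷ 4 ∷ 1 ∷ [])) (use 5 (3 ∷ 2 ∷ 5 ∷ 0 ∷ []))))) (split 1 6 (split 2 5
      (split 3 5 (use 0 (5 ∷ 0 ∷ 3 ∷ 1 ∷ 2 ∷ 4 ∷ [])) (split 3 6 (split 2 6 (use 0 (4 ∷ 0 ∷ 3 ∷ 5 ∷ 2 ∷ 6 ∷ []))
      (use 0 (2 ∷ 5 ∷ 4 ∷ 6 ∷ 1 ∷ 0 ∷ []))) (use 5 (3 ∷ 4 ∷ 6 ∷ 5 ∷ [])))) (split 2 6 (use 1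
      (5 ∷ 2 ∷ 4 ∷ 6 ∷ 0 ∷ 1 ∷ [])) (use 5 (2 ∷ 4 ∷ 6 ∷ 5 ∷ [])))) (use 5 (1 ∷ 4 ∷ 6 ∷ 5 ∷ []))) ∷ use 5
      (0 ∷ 4 ∷ 5 ∷ 6 ∷ []) ∷ [])
      refl ∷ closed₃

    -- Two adjacent vertices of the same colour give a K₄ or a 2K₂, or else exactly one of them sees
    -- some vertex of the triangle and a gem arises, which is closed by now.
    closed₅ : All Closed (X₅ ∷ X₄ ∷ X₃ ∷ X₂ ∷ X₁ ∷ gem⁺-pattern ∷ K₄ ∷ 2K₂ ∷ [])
    closed₅ = colours-sound closed₄ 3 X₅
      (ask 2 (ask 0 (colour 1F) (colour 0F)) (ask 1 (colour 2F) (colour 3F)))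
      (use 5 (0 ∷ 2 ∷ 3 ∷ 4 ∷ []) ∷ split 1 3 (split 1 4 (use 5 (1 ∷ 4 ∷ 2 ∷ 3 ∷ [])) (use 0
      (0 ∷ 1 ∷ 3 ∷ 4 ∷ 2 ∷ []))) (split 1 4 (use 0 (0 ∷ 1 ∷ 4 ∷ 3 ∷ 2 ∷ [])) (use 6
      (1 ∷ 0 ∷ 4 ∷ 3 ∷ []))) ∷ split 0 3 (split 0 4 (use 5 (0 ∷ 4 ∷ 1 ∷ 3 ∷ [])) (use 0
      (2 ∷ 0 ∷ 3 ∷ 4 ∷ 1 ∷ []))) (split 0 4 (use 0 (2 ∷ 0 ∷ 4 ∷ 3 ∷ 1 ∷ [])) (use 6 (0 ∷ 2 ∷ 4 ∷ 3 ∷ []))) ∷ use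
      6 (1 ∷ 2 ∷ 3 ∷ 4 ∷ []) ∷ [])
      refl ∷ closed₄

  -- Wagon's bound gives three colours if there is no triangle, and a triangle is the closed pattern
  -- `X₅`.
  four-colouring₂ : Colouring G 4
  four-colouring₂ with clique? 3 G
  ... | no ¬K₃ = relax {G} (ℕₚ.n≤1+n 3) (wagon 2 G ¬2K₂ ¬K₃)
  ... | yes (q , clique) = All.head closed₅ (nth (q 0F) (q 0F ∷ q 1F ∷ q 2F ∷ []))
          (clique 0F 1F (λ ()) ∷ clique 0F 2F (λ ()) ∷ clique 1F 2F (λ ()) ∷ [])

-- {3K₂, K₃}-free graphs are 4-colourable

K₃ 3K₂ : Pattern
K₃ = pattern-of 3 ((0 , 1) ∷ (0 , 2) ∷ (1 , 2) ∷ [])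
3K₂ = pattern-of 6 ((0 , 1) ∷ (2 , 3) ∷ (4 , 5) ∷ [])

-- Y₄ is 2C₅, Y₃ adds to it a vertex with two neighbours on each pentagon, Y₁₂ is C₅ ∪ K₂ and Y₁₃ is 2K₂.
-- The case distinctions were found by computer.
Y₁ Y₂ Y₃ Y₄ Y₅ Y₆ Y₇ Y₈ Y₉ Y₁₀ Y₁₁ Y₁₂ Y₁₃ : Pattern
Y₁ = pattern-of 13
  ((0 , 1) ∷ (0 , 4) ∷ (0 , 11) ∷ (0 , 12) ∷ (1 , 2) ∷ (1 , 10) ∷ (2 , 3) ∷ (2 , 11) ∷ (2 , 12) ∷ (3 , 4) ∷ (4
  , 10) ∷ (5 , 6) ∷ (5 , 9) ∷ (5 , 11) ∷ (5 , 12) ∷ (6 , 7) ∷ (6 , 10) ∷ (7 , 8) ∷ (7 , 11) ∷ (8 , 9) ∷ (8 ,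
  12) ∷ (9 , 10) ∷ [])

Y₂ = pattern-of 13
  ((0 , 1) ∷ (0 , 4) ∷ (1 , 2) ∷ (1 , 10) ∷ (2 , 3) ∷ (2 , 11) ∷ (2 , 12) ∷ (3 , 4) ∷ (4 , 10) ∷ (4 , 11) ∷ (4
  , 12) ∷ (5 , 6) ∷ (5 , 9) ∷ (5 , 11) ∷ (5 , 12) ∷ (6 , 7) ∷ (6 , 10) ∷ (7 , 8) ∷ (7 , 11) ∷ (8 , 9) ∷ (8 ,
  12) ∷ (9 , 10) ∷ [])

Y₃ = pattern-of 11
  ((0 , 1) ∷ (0 , 4) ∷ (1 , 2) ∷ (1 , 10) ∷ (2 , 3) ∷ (3 , 4) ∷ (4 , 10) ∷ (5 , 6) ∷ (5 , 9) ∷ (6 , 7) ∷ (6 ,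
  10) ∷ (7 , 8) ∷ (8 , 9) ∷ (9 , 10) ∷ [])

Y₄ = pattern-of 10
  ((0 , 1) ∷ (0 , 4) ∷ (1 , 2) ∷ (2 , 3) ∷ (3 , 4) ∷ (5 , 6) ∷ (5 , 9) ∷ (6 , 7) ∷ (7 , 8) ∷ (8 , 9) ∷ [])

Y₅ = pattern-of 10
  ((0 , 1) ∷ (0 , 4) ∷ (1 , 2) ∷ (2 , 3) ∷ (3 , 4) ∷ (3 , 7) ∷ (3 , 8) ∷ (5 , 6) ∷ (5 , 7) ∷ (6 , 8) ∷ (7 ,
  9) ∷ (8 , 9) ∷ [])

Y₆ = pattern-of 9
  ((0 , 1) ∷ (0 , 4) ∷ (1 , 2) ∷ (2 , 3) ∷ (3 , 4) ∷ (3 , 7) ∷ (3 , 8) ∷ (5 , 6) ∷ (5 , 7) ∷ (6 , 8) ∷ [])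

Y₇ = pattern-of 10
  ((0 , 1) ∷ (0 , 4) ∷ (1 , 2) ∷ (2 , 3) ∷ (2 , 8) ∷ (3 , 4) ∷ (4 , 7) ∷ (4 , 8) ∷ (5 , 6) ∷ (5 , 7) ∷ (6 ,
  8) ∷ (7 , 9) ∷ (8 , 9) ∷ [])

Y₈ = pattern-of 10
  ((0 , 1) ∷ (0 , 4) ∷ (1 , 2) ∷ (2 , 3) ∷ (2 , 7) ∷ (3 , 4) ∷ (4 , 8) ∷ (5 , 6) ∷ (5 , 7) ∷ (6 , 8) ∷ (7 ,
  9) ∷ (8 , 9) ∷ [])

Y₉ = pattern-of 12
  ((0 , 1) ∷ (0 , 4) ∷ (1 , 2) ∷ (1 , 10) ∷ (1 , 11) ∷ (2 , 3) ∷ (2 , 7) ∷ (2 , 8) ∷ (3 , 4) ∷ (4 , 7) ∷ (4 ,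
  8) ∷ (4 , 10) ∷ (4 , 11) ∷ (5 , 6) ∷ (5 , 7) ∷ (5 , 10) ∷ (6 , 8) ∷ (6 , 11) ∷ (7 , 9) ∷ (8 , 9) ∷ (9 ,
  10) ∷ (9 , 11) ∷ [])

Y₁₀ = pattern-of 13
  ((0 , 1) ∷ (0 , 4) ∷ (1 , 2) ∷ (1 , 10) ∷ (1 , 11) ∷ (2 , 3) ∷ (2 , 7) ∷ (2 , 8) ∷ (3 , 4) ∷ (4 , 7) ∷ (4 ,
  8) ∷ (4 , 10) ∷ (4 , 11) ∷ (5 , 6) ∷ (5 , 7) ∷ (5 , 10) ∷ (6 , 8) ∷ (6 , 11) ∷ (7 , 9) ∷ (8 , 9) ∷ (10 ,
  12) ∷ (11 , 12) ∷ [])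

Y₁₁ = pattern-of 10
  ((0 , 1) ∷ (0 , 4) ∷ (1 , 2) ∷ (2 , 3) ∷ (2 , 7) ∷ (2 , 8) ∷ (3 , 4) ∷ (4 , 7) ∷ (4 , 8) ∷ (5 , 6) ∷ (5 ,
  7) ∷ (6 , 8) ∷ (7 , 9) ∷ (8 , 9) ∷ [])

Y₁₂ = pattern-of 7
  ((0 , 1) ∷ (0 , 4) ∷ (1 , 2) ∷ (2 , 3) ∷ (3 , 4) ∷ (5 , 6) ∷ [])

Y₁₃ = pattern-of 4
  ((0 , 1) ∷ (2 , 3) ∷ [])

module _ (G : FinGraph) (¬3K₂ : ¬ Matching G 3) (¬K₃ : ¬ Clique G 3) where
  open Semantics G
  private
    closed₀ : All Closed (3K₂ ∷ K₃ ∷ [])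
    closed₀ =
      (λ { ρ (e₀₁ ∷ e₀₂ ∷ e₁₂ ∷ e₀₃ ∷ e₁₃ ∷ e₂₃ ∷ e₀₄ ∷ e₁₄ ∷ e₂₄ ∷ e₃₄ ∷ e₀₅ ∷ e₁₅ ∷ e₂₅ ∷ e₃₅ ∷ e₄₅ ∷ []) →
        ⊥-elim (¬3K₂ (ρ 0 , ρ 1 , e₀₁ , beside-edge (far G (ρ 0) (ρ 1))
          {(ρ 2 , cong not e₀₂) , cong not e₁₂} {(ρ 3 , cong not e₀₃) , cong not e₁₃}
          {(ρ 4 , cong not e₀₄) , cong not e₁₄} {(ρ 5 , cong not e₀₅) , cong not e₁₅}
          e₂₃ e₄₅ e₂₄ e₃₄ e₂₅ e₃₅)) }) ∷
      (λ { ρ (e₀₁ ∷ e₀₂ ∷ e₁₂ ∷ []) → ⊥-elim (¬K₃ (triangle G e₀₁ e₀₂ e₁₂)) }) ∷ []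

    -- `Y₁` and `Y₂` extend `Y₃` by the vertices 11 and 12. Here `ab` is the edge 6 10 and `uv` the
    -- edge 0 11, and the new pentagon is 0 13 15 14 11.
    closed₁ : All Closed (Y₁ ∷ 3K₂ ∷ K₃ ∷ [])
    closed₁ = grows-sound G ¬3K₂ ¬K₃ closed₀ 13 Y₁ 6 10 0 11
      (split 1 13 (use 1 (1 ∷ 13 ∷ 0 ∷ [])) (split 4 13 (use 1 (4 ∷ 13 ∷ 0 ∷ [])) (split 12 13 (use 1
      (12 ∷ 13 ∷ 0 ∷ [])) (split 2 14 (use 1 (2 ∷ 14 ∷ 11 ∷ [])) (split 3 15 (use 0
      (3 ∷ 15 ∷ 0 ∷ 11 ∷ 6 ∷ 10 ∷ [])) (split 3 14 (split 3 13 (split 2 13 (use 1 (2 ∷ 13 ∷ 3 ∷ [])) (split 7 13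
      (use 0 (7 ∷ 13 ∷ 2 ∷ 12 ∷ 4 ∷ 10 ∷ [])) (use 0 (7 ∷ 11 ∷ 13 ∷ 3 ∷ 1 ∷ 10 ∷ [])))) (use 0
      (3 ∷ 14 ∷ 13 ∷ 0 ∷ 6 ∷ 10 ∷ []))) (split 3 13 (use 0 (3 ∷ 13 ∷ 6 ∷ 10 ∷ 11 ∷ 14 ∷ [])) (split 2 13 (split
      2 15 (use 1 (2 ∷ 15 ∷ 13 ∷ [])) (use 0 (2 ∷ 3 ∷ 15 ∷ 14 ∷ 6 ∷ 10 ∷ []))) (use 0
      (2 ∷ 3 ∷ 13 ∷ 0 ∷ 6 ∷ 10 ∷ []))))))))))
      refl ∷ closed₀

    closed₂ : All Closed (Y₂ ∷ Y₁ ∷ 3K₂ ∷ K₃ ∷ [])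
    closed₂ = grows-sound G ¬3K₂ ¬K₃ closed₁ 13 Y₂ 4 10 7 8
      (split 6 13 (use 2 (6 ∷ 13 ∷ 7 ∷ [])) (split 11 13 (use 2 (11 ∷ 13 ∷ 7 ∷ [])) (split 9 14 (use 2
      (9 ∷ 14 ∷ 8 ∷ [])) (split 12 14 (use 2 (12 ∷ 14 ∷ 8 ∷ [])) (split 2 13 (split 12 13 (use 2
      (12 ∷ 13 ∷ 2 ∷ [])) (split 0 13 (use 1 (0 ∷ 13 ∷ 6 ∷ 10 ∷ 8 ∷ 12 ∷ [])) (split 5 13 (split 9 13 (use 2
      (9 ∷ 13 ∷ 5 ∷ [])) (use 1 (9 ∷ 8 ∷ 13 ∷ 2 ∷ 0 ∷ 4 ∷ []))) (use 1 (5 ∷ 6 ∷ 13 ∷ 2 ∷ 0 ∷ 4 ∷ []))))) (split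
      0 13 (use 1 (0 ∷ 13 ∷ 2 ∷ 11 ∷ 6 ∷ 10 ∷ [])) (split 2 14 (use 1 (2 ∷ 14 ∷ 4 ∷ 10 ∷ 7 ∷ 13 ∷ [])) (split 0
      14 (use 1 (0 ∷ 14 ∷ 2 ∷ 12 ∷ 9 ∷ 10 ∷ [])) (split 9 13 (split 5 13 (use 2 (5 ∷ 13 ∷ 9 ∷ [])) (split 5 14
      (use 1 (5 ∷ 14 ∷ 0 ∷ 4 ∷ 7 ∷ 13 ∷ [])) (split 6 14 (use 1 (6 ∷ 14 ∷ 0 ∷ 4 ∷ 9 ∷ 13 ∷ [])) (use 1
      (6 ∷ 5 ∷ 14 ∷ 8 ∷ 0 ∷ 4 ∷ []))))) (split 1 13 (use 1 (1 ∷ 13 ∷ 4 ∷ 11 ∷ 8 ∷ 9 ∷ [])) (split 3 13 (use 1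
      (3 ∷ 13 ∷ 0 ∷ 1 ∷ 8 ∷ 9 ∷ [])) (use 1 (3 ∷ 2 ∷ 13 ∷ 7 ∷ 9 ∷ 10 ∷ [])))))))))))))
      refl ∷ closed₁

    closed₃ : All Closed (Y₃ ∷ Y₂ ∷ Y₁ ∷ 3K₂ ∷ K₃ ∷ [])
    closed₃ = grows-sound G ¬3K₂ ¬K₃ closed₂ 11 Y₃ 1 10 7 8
      (split 6 11 (use 3 (6 ∷ 11 ∷ 7 ∷ [])) (split 9 12 (use 3 (9 ∷ 12 ∷ 8 ∷ [])) (split 3 13 (use 2
      (3 ∷ 13 ∷ 1 ∷ 10 ∷ 7 ∷ 8 ∷ [])) (split 5 13 (use 2 (5 ∷ 13 ∷ 1 ∷ 10 ∷ 7 ∷ 8 ∷ [])) (split 2 13 (split 2 11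
      (use 3 (2 ∷ 11 ∷ 13 ∷ [])) (split 2 12 (use 3 (2 ∷ 12 ∷ 13 ∷ [])) (split 4 13 (split 4 11 (use 3
      (4 ∷ 11 ∷ 13 ∷ [])) (split 4 12 (use 3 (4 ∷ 12 ∷ 13 ∷ [])) (split 9 11 (split 5 11 (use 3
      (5 ∷ 11 ∷ 9 ∷ [])) (split 5 12 (use 2 (5 ∷ 12 ∷ 1 ∷ 2 ∷ 7 ∷ 11 ∷ [])) (split 6 12 (use 2
      (6 ∷ 12 ∷ 1 ∷ 2 ∷ 9 ∷ 11 ∷ [])) (use 2 (6 ∷ 5 ∷ 12 ∷ 8 ∷ 1 ∷ 2 ∷ []))))) (split 3 11 (split 0 11 (split 5
      11 (split 3 12 (split 5 12 (split 6 12 (use 3 (6 ∷ 12 ∷ 5 ∷ [])) (split 0 12 (use 1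
      (0 ∷ 4 ∷ 3 ∷ 2 ∷ 1 ∷ 5 ∷ 9 ∷ 8 ∷ 7 ∷ 6 ∷ 10 ∷ 12 ∷ 11 ∷ [])) (use 2 (0 ∷ 1 ∷ 12 ∷ 3 ∷ 6 ∷ 7 ∷ [])))) (use
      2 (5 ∷ 11 ∷ 12 ∷ 8 ∷ 1 ∷ 2 ∷ []))) (use 2 (3 ∷ 11 ∷ 12 ∷ 8 ∷ 1 ∷ 10 ∷ []))) (use 2
      (5 ∷ 9 ∷ 11 ∷ 7 ∷ 1 ∷ 2 ∷ []))) (use 2 (0 ∷ 1 ∷ 11 ∷ 3 ∷ 8 ∷ 9 ∷ []))) (use 2
      (3 ∷ 2 ∷ 11 ∷ 7 ∷ 9 ∷ 10 ∷ [])))))) (use 2 (4 ∷ 10 ∷ 13 ∷ 2 ∷ 7 ∷ 8 ∷ []))))) (split 0 13 (use 2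
      (0 ∷ 13 ∷ 2 ∷ 3 ∷ 7 ∷ 8 ∷ [])) (split 4 13 (use 2 (4 ∷ 13 ∷ 1 ∷ 2 ∷ 7 ∷ 8 ∷ [])) (split 3 11 (split 2 11
      (use 3 (2 ∷ 11 ∷ 3 ∷ [])) (split 4 11 (use 3 (4 ∷ 11 ∷ 3 ∷ [])) (split 3 12 (split 2 12 (use 3
      (2 ∷ 12 ∷ 3 ∷ [])) (split 4 12 (use 3 (4 ∷ 12 ∷ 3 ∷ [])) (split 9 11 (split 5 11 (use 3 (5 ∷ 11 ∷ 9 ∷ []))
      (split 9 13 (use 3 (9 ∷ 13 ∷ 11 ∷ [])) (split 5 12 (use 2 (5 ∷ 12 ∷ 1 ∷ 2 ∷ 7 ∷ 11 ∷ [])) (use 2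
      (5 ∷ 9 ∷ 12 ∷ 13 ∷ 1 ∷ 2 ∷ []))))) (split 0 11 (split 5 11 (split 5 12 (split 6 12 (use 3
      (6 ∷ 12 ∷ 5 ∷ [])) (split 0 12 (use 1 (0 ∷ 4 ∷ 3 ∷ 2 ∷ 1 ∷ 5 ∷ 9 ∷ 8 ∷ 7 ∷ 6 ∷ 10 ∷ 12 ∷ 11 ∷ [])) (use 2
      (0 ∷ 1 ∷ 12 ∷ 3 ∷ 6 ∷ 7 ∷ [])))) (use 2 (5 ∷ 11 ∷ 12 ∷ 8 ∷ 1 ∷ 2 ∷ []))) (use 2
      (5 ∷ 9 ∷ 11 ∷ 7 ∷ 1 ∷ 2 ∷ []))) (use 2 (0 ∷ 1 ∷ 11 ∷ 3 ∷ 8 ∷ 9 ∷ [])))))) (use 2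
      (3 ∷ 11 ∷ 12 ∷ 8 ∷ 1 ∷ 10 ∷ []))))) (split 3 12 (use 2 (3 ∷ 12 ∷ 1 ∷ 10 ∷ 7 ∷ 11 ∷ [])) (split 6 13 (split
      6 12 (use 3 (6 ∷ 12 ∷ 13 ∷ [])) (split 2 12 (split 9 13 (split 9 11 (use 3 (9 ∷ 11 ∷ 13 ∷ [])) (split 2 11
      (split 0 11 (split 4 11 (use 3 (4 ∷ 11 ∷ 0 ∷ [])) (split 0 12 (split 4 12 (use 3 (4 ∷ 12 ∷ 0 ∷ [])) (use 1
      (0 ∷ 1 ∷ 2 ∷ 3 ∷ 4 ∷ 13 ∷ 9 ∷ 8 ∷ 7 ∷ 6 ∷ 10 ∷ 12 ∷ 11 ∷ []))) (use 2 (0 ∷ 11 ∷ 12 ∷ 8 ∷ 6 ∷ 10 ∷ []))))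
      (split 4 11 (split 0 12 (use 2 (0 ∷ 12 ∷ 7 ∷ 11 ∷ 9 ∷ 10 ∷ [])) (split 4 12 (use 0
      (0 ∷ 1 ∷ 2 ∷ 3 ∷ 4 ∷ 13 ∷ 9 ∷ 8 ∷ 7 ∷ 6 ∷ 10 ∷ 12 ∷ 11 ∷ [])) (use 2 (4 ∷ 0 ∷ 12 ∷ 2 ∷ 6 ∷ 7 ∷ [])))) (use
      2 (4 ∷ 0 ∷ 11 ∷ 2 ∷ 8 ∷ 9 ∷ [])))) (use 2 (2 ∷ 3 ∷ 11 ∷ 7 ∷ 9 ∷ 10 ∷ [])))) (use 2
      (9 ∷ 8 ∷ 13 ∷ 6 ∷ 0 ∷ 1 ∷ []))) (use 2 (2 ∷ 3 ∷ 12 ∷ 8 ∷ 6 ∷ 10 ∷ [])))) (split 9 13 (use 2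
      (9 ∷ 13 ∷ 0 ∷ 1 ∷ 6 ∷ 7 ∷ [])) (split 5 11 (split 9 11 (use 3 (9 ∷ 11 ∷ 5 ∷ [])) (split 0 11 (split 4 11
      (use 3 (4 ∷ 11 ∷ 0 ∷ [])) (use 2 (4 ∷ 3 ∷ 11 ∷ 13 ∷ 8 ∷ 9 ∷ []))) (use 2 (0 ∷ 1 ∷ 11 ∷ 13 ∷ 8 ∷ 9 ∷ []))))
      (split 0 11 (split 4 11 (use 3 (4 ∷ 11 ∷ 0 ∷ [])) (use 2 (4 ∷ 3 ∷ 11 ∷ 13 ∷ 5 ∷ 6 ∷ []))) (use 2
      (0 ∷ 1 ∷ 11 ∷ 13 ∷ 5 ∷ 6 ∷ [])))))))))))))))
      refl ∷ closed₂

    -- The one pattern of this series that is closed by a colouring scheme. Two leaves share the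
    -- colour `0F`: the vertices seeing 4 but not 3, and those seeing 7 but neither 3 nor 4.
    closed₄ : All Closed (Y₄ ∷ Y₃ ∷ Y₂ ∷ Y₁ ∷ 3K₂ ∷ K₃ ∷ [])
    closed₄ = colours-sound closed₃ 10 Y₄
      (ask 3 (colour 2F) (ask 4 (colour 0F) (ask 7 (colour 0F) (ask 9 (colour 3F) (colour 1F)))))
      (use 4 (3 ∷ 10 ∷ 11 ∷ []) ∷ use 4 (4 ∷ 10 ∷ 11 ∷ []) ∷ split 0 10 (use 4 (0 ∷ 10 ∷ 4 ∷ [])) (split 7 10
      (use 4 (7 ∷ 10 ∷ 11 ∷ [])) (split 6 11 (use 4 (6 ∷ 11 ∷ 7 ∷ [])) (split 8 11 (use 4 (8 ∷ 11 ∷ 7 ∷ []))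
      (split 5 11 (split 5 10 (use 4 (5 ∷ 10 ∷ 11 ∷ [])) (split 9 11 (use 4 (9 ∷ 11 ∷ 5 ∷ [])) (split 1 11 (use
      3 (1 ∷ 11 ∷ 3 ∷ 4 ∷ 8 ∷ 9 ∷ [])) (split 2 11 (split 0 11 (use 0
      (1 ∷ 0 ∷ 4 ∷ 3 ∷ 2 ∷ 6 ∷ 5 ∷ 9 ∷ 8 ∷ 7 ∷ 11 ∷ [])) (use 3 (0 ∷ 4 ∷ 11 ∷ 2 ∷ 8 ∷ 9 ∷ []))) (split 0 11 (use
      3 (0 ∷ 11 ∷ 2 ∷ 3 ∷ 8 ∷ 9 ∷ [])) (split 1 10 (split 2 10 (use 4 (2 ∷ 10 ∷ 1 ∷ [])) (split 8 10 (split 9 10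
      (use 4 (9 ∷ 10 ∷ 8 ∷ [])) (use 0 (7 ∷ 8 ∷ 9 ∷ 5 ∷ 11 ∷ 0 ∷ 1 ∷ 2 ∷ 3 ∷ 4 ∷ 10 ∷ []))) (split 9 10 (use 0
      (5 ∷ 9 ∷ 8 ∷ 7 ∷ 11 ∷ 0 ∷ 1 ∷ 2 ∷ 3 ∷ 4 ∷ 10 ∷ [])) (use 3 (9 ∷ 8 ∷ 10 ∷ 11 ∷ 2 ∷ 3 ∷ []))))) (split 8 10
      (split 9 10 (use 4 (9 ∷ 10 ∷ 8 ∷ [])) (split 2 10 (use 0
      (3 ∷ 2 ∷ 1 ∷ 0 ∷ 4 ∷ 7 ∷ 8 ∷ 9 ∷ 5 ∷ 11 ∷ 10 ∷ [])) (use 3 (2 ∷ 1 ∷ 10 ∷ 4 ∷ 5 ∷ 9 ∷ [])))) (split 2 10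
      (split 9 10 (use 0 (5 ∷ 9 ∷ 8 ∷ 7 ∷ 11 ∷ 3 ∷ 2 ∷ 1 ∷ 0 ∷ 4 ∷ 10 ∷ [])) (use 3
      (9 ∷ 8 ∷ 10 ∷ 11 ∷ 0 ∷ 1 ∷ []))) (use 3 (2 ∷ 1 ∷ 10 ∷ 4 ∷ 7 ∷ 8 ∷ [])))))))))) (split 1 11 (use 3
      (1 ∷ 11 ∷ 3 ∷ 4 ∷ 5 ∷ 6 ∷ [])) (split 9 11 (split 9 10 (use 4 (9 ∷ 10 ∷ 11 ∷ [])) (split 2 11 (split 0 11
      (use 0 (1 ∷ 0 ∷ 4 ∷ 3 ∷ 2 ∷ 8 ∷ 7 ∷ 6 ∷ 5 ∷ 9 ∷ 11 ∷ [])) (use 3 (0 ∷ 4 ∷ 11 ∷ 2 ∷ 5 ∷ 6 ∷ []))) (split 0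
      11 (use 3 (0 ∷ 11 ∷ 2 ∷ 3 ∷ 5 ∷ 6 ∷ [])) (split 1 10 (split 2 10 (use 4 (2 ∷ 10 ∷ 1 ∷ [])) (split 5 10
      (split 6 10 (use 4 (6 ∷ 10 ∷ 5 ∷ [])) (use 0 (9 ∷ 5 ∷ 6 ∷ 7 ∷ 11 ∷ 0 ∷ 1 ∷ 2 ∷ 3 ∷ 4 ∷ 10 ∷ []))) (split 6
      10 (use 0 (7 ∷ 6 ∷ 5 ∷ 9 ∷ 11 ∷ 0 ∷ 1 ∷ 2 ∷ 3 ∷ 4 ∷ 10 ∷ [])) (use 3 (6 ∷ 5 ∷ 10 ∷ 11 ∷ 2 ∷ 3 ∷ [])))))
      (split 5 10 (split 6 10 (use 4 (6 ∷ 10 ∷ 5 ∷ [])) (split 2 10 (use 0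
      (3 ∷ 2 ∷ 1 ∷ 0 ∷ 4 ∷ 9 ∷ 5 ∷ 6 ∷ 7 ∷ 11 ∷ 10 ∷ [])) (use 3 (2 ∷ 1 ∷ 10 ∷ 4 ∷ 6 ∷ 7 ∷ [])))) (split 2 10
      (split 6 10 (use 0 (7 ∷ 6 ∷ 5 ∷ 9 ∷ 11 ∷ 3 ∷ 2 ∷ 1 ∷ 0 ∷ 4 ∷ 10 ∷ [])) (use 3
      (6 ∷ 5 ∷ 10 ∷ 11 ∷ 0 ∷ 1 ∷ []))) (use 3 (2 ∷ 1 ∷ 10 ∷ 4 ∷ 5 ∷ 9 ∷ [])))))))) (use 3
      (9 ∷ 5 ∷ 11 ∷ 7 ∷ 3 ∷ 4 ∷ [])))))))) ∷ use 4 (7 ∷ 10 ∷ 11 ∷ []) ∷ use 4 (9 ∷ 10 ∷ 11 ∷ []) ∷ split 5 10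
      (split 6 10 (use 4 (6 ∷ 10 ∷ 5 ∷ [])) (split 8 10 (split 8 11 (use 4 (8 ∷ 11 ∷ 10 ∷ [])) (split 6 11 (use
      3 (6 ∷ 11 ∷ 3 ∷ 4 ∷ 8 ∷ 9 ∷ [])) (use 3 (6 ∷ 7 ∷ 11 ∷ 10 ∷ 3 ∷ 4 ∷ [])))) (use 3
      (8 ∷ 7 ∷ 10 ∷ 5 ∷ 3 ∷ 4 ∷ [])))) (split 5 11 (split 6 11 (use 4 (6 ∷ 11 ∷ 5 ∷ [])) (split 6 10 (split 8 10
      (split 8 11 (use 4 (8 ∷ 11 ∷ 10 ∷ [])) (use 3 (8 ∷ 7 ∷ 11 ∷ 5 ∷ 3 ∷ 4 ∷ []))) (use 3
      (8 ∷ 9 ∷ 10 ∷ 6 ∷ 3 ∷ 4 ∷ []))) (use 3 (6 ∷ 7 ∷ 10 ∷ 11 ∷ 3 ∷ 4 ∷ [])))) (use 3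
      (5 ∷ 9 ∷ 11 ∷ 10 ∷ 3 ∷ 4 ∷ []))) ∷ [])
      refl ∷ closed₃

    -- `Y₅`, `Y₇`, `Y₈` and `Y₁₁` are the pentagons 0 1 2 3 4 and 5 6 8 9 7 joined by two to four
    -- edges. In `Y₆` the pentagons 0 1 2 3 4 and 3 7 5 6 8 share the vertex 3. `Y₉` and `Y₁₀`
    -- extend `Y₁₁` and are closed before it.
    closed₅ : All Closed (Y₅ ∷ Y₄ ∷ Y₃ ∷ Y₂ ∷ Y₁ ∷ 3K₂ ∷ K₃ ∷ [])
    closed₅ = grows-sound G ¬3K₂ ¬K₃ closed₄ 10 Y₅ 5 7 0 1
      (split 4 10 (use 5 (4 ∷ 10 ∷ 0 ∷ [])) (split 2 11 (use 5 (2 ∷ 11 ∷ 1 ∷ [])) (split 8 12 (use 4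
      (8 ∷ 12 ∷ 0 ∷ 1 ∷ 5 ∷ 7 ∷ [])) (split 6 12 (split 6 10 (use 5 (6 ∷ 10 ∷ 12 ∷ [])) (split 6 11 (use 5
      (6 ∷ 11 ∷ 12 ∷ [])) (split 3 12 (split 2 12 (use 5 (2 ∷ 12 ∷ 3 ∷ [])) (split 4 12 (use 5
      (4 ∷ 12 ∷ 3 ∷ [])) (split 2 10 (split 4 11 (use 4 (4 ∷ 11 ∷ 2 ∷ 10 ∷ 5 ∷ 6 ∷ [])) (use 4
      (4 ∷ 0 ∷ 11 ∷ 12 ∷ 5 ∷ 7 ∷ []))) (use 4 (2 ∷ 1 ∷ 10 ∷ 12 ∷ 5 ∷ 7 ∷ []))))) (use 4
      (3 ∷ 7 ∷ 12 ∷ 6 ∷ 0 ∷ 1 ∷ []))))) (split 3 12 (use 4 (3 ∷ 12 ∷ 0 ∷ 1 ∷ 5 ∷ 6 ∷ [])) (split 9 12 (use 4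
      (9 ∷ 12 ∷ 0 ∷ 1 ∷ 5 ∷ 6 ∷ [])) (split 2 10 (split 2 12 (use 5 (2 ∷ 12 ∷ 10 ∷ [])) (split 4 11 (use 4
      (4 ∷ 11 ∷ 2 ∷ 10 ∷ 5 ∷ 7 ∷ [])) (split 4 12 (use 4 (4 ∷ 12 ∷ 1 ∷ 2 ∷ 5 ∷ 6 ∷ [])) (use 4
      (4 ∷ 0 ∷ 12 ∷ 11 ∷ 5 ∷ 7 ∷ []))))) (split 2 12 (split 4 12 (use 1
      (12 ∷ 4 ∷ 0 ∷ 1 ∷ 2 ∷ 9 ∷ 7 ∷ 5 ∷ 6 ∷ 8 ∷ 3 ∷ [])) (use 4 (4 ∷ 0 ∷ 12 ∷ 2 ∷ 5 ∷ 6 ∷ []))) (use 4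
      (2 ∷ 1 ∷ 12 ∷ 10 ∷ 5 ∷ 7 ∷ []))))))))))
      refl ∷ closed₄

    closed₆ : All Closed (Y₆ ∷ Y₅ ∷ Y₄ ∷ Y₃ ∷ Y₂ ∷ Y₁ ∷ 3K₂ ∷ K₃ ∷ [])
    closed₆ = grows-sound G ¬3K₂ ¬K₃ closed₅ 9 Y₆ 0 4 5 7
      (split 6 9 (use 6 (6 ∷ 9 ∷ 5 ∷ [])) (split 3 10 (use 6 (3 ∷ 10 ∷ 7 ∷ [])) (split 8 11 (use 5
      (8 ∷ 11 ∷ 0 ∷ 4 ∷ 5 ∷ 7 ∷ [])) (split 6 10 (split 8 10 (use 6 (8 ∷ 10 ∷ 6 ∷ [])) (split 6 11 (use 6
      (6 ∷ 11 ∷ 10 ∷ [])) (split 8 9 (use 5 (8 ∷ 9 ∷ 0 ∷ 4 ∷ 7 ∷ 10 ∷ [])) (use 5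
      (8 ∷ 6 ∷ 9 ∷ 11 ∷ 0 ∷ 4 ∷ []))))) (split 1 10 (use 5 (1 ∷ 10 ∷ 3 ∷ 4 ∷ 5 ∷ 6 ∷ [])) (split 2 10 (use 5
      (2 ∷ 10 ∷ 0 ∷ 4 ∷ 5 ∷ 6 ∷ [])) (split 8 10 (use 0 (0 ∷ 1 ∷ 2 ∷ 3 ∷ 4 ∷ 6 ∷ 5 ∷ 8 ∷ 7 ∷ 10 ∷ [])) (use 5
      (8 ∷ 6 ∷ 10 ∷ 7 ∷ 0 ∷ 1 ∷ [])))))))))
      refl ∷ closed₅

    closed₇ : All Closed (Y₇ ∷ Y₆ ∷ Y₅ ∷ Y₄ ∷ Y₃ ∷ Y₂ ∷ Y₁ ∷ 3K₂ ∷ K₃ ∷ [])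
    closed₇ = grows-sound G ¬3K₂ ¬K₃ closed₆ 10 Y₇ 1 2 4 7
      (split 0 10 (use 7 (0 ∷ 10 ∷ 4 ∷ [])) (split 3 10 (use 7 (3 ∷ 10 ∷ 4 ∷ [])) (split 5 11 (use 7
      (5 ∷ 11 ∷ 7 ∷ [])) (split 6 12 (use 6 (6 ∷ 12 ∷ 1 ∷ 2 ∷ 4 ∷ 7 ∷ [])) (split 5 10 (split 6 10 (use 7
      (6 ∷ 10 ∷ 5 ∷ [])) (split 5 12 (use 7 (5 ∷ 12 ∷ 10 ∷ [])) (split 6 11 (use 6
      (6 ∷ 11 ∷ 1 ∷ 2 ∷ 4 ∷ 10 ∷ [])) (use 6 (6 ∷ 5 ∷ 11 ∷ 12 ∷ 1 ∷ 2 ∷ []))))) (split 6 10 (use 0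
      (6 ∷ 5 ∷ 7 ∷ 4 ∷ 10 ∷ 1 ∷ 2 ∷ 0 ∷ 3 ∷ [])) (use 6 (6 ∷ 5 ∷ 10 ∷ 4 ∷ 1 ∷ 2 ∷ []))))))))
      refl ∷ closed₆

    closed₈ : All Closed (Y₈ ∷ Y₇ ∷ Y₆ ∷ Y₅ ∷ Y₄ ∷ Y₃ ∷ Y₂ ∷ Y₁ ∷ 3K₂ ∷ K₃ ∷ [])
    closed₈ = grows-sound G ¬3K₂ ¬K₃ closed₇ 10 Y₈ 0 4 2 7
      (split 1 10 (use 8 (1 ∷ 10 ∷ 2 ∷ [])) (split 3 10 (use 8 (3 ∷ 10 ∷ 2 ∷ [])) (split 5 11 (use 8
      (5 ∷ 11 ∷ 7 ∷ [])) (split 6 12 (use 7 (6 ∷ 12 ∷ 0 ∷ 4 ∷ 2 ∷ 7 ∷ [])) (split 6 10 (split 5 10 (use 8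
      (5 ∷ 10 ∷ 6 ∷ [])) (use 1 (5 ∷ 6 ∷ 10 ∷ 2 ∷ 7 ∷ 0 ∷ 4 ∷ 1 ∷ 3 ∷ []))) (split 5 10 (split 5 12 (use 8
      (5 ∷ 12 ∷ 10 ∷ [])) (split 6 11 (use 7 (6 ∷ 11 ∷ 0 ∷ 4 ∷ 2 ∷ 10 ∷ [])) (use 7
      (6 ∷ 5 ∷ 11 ∷ 12 ∷ 0 ∷ 4 ∷ [])))) (use 7 (5 ∷ 6 ∷ 10 ∷ 2 ∷ 0 ∷ 4 ∷ []))))))))
      refl ∷ closed₇

    closed₉ : All Closed (Y₉ ∷ Y₈ ∷ Y₇ ∷ Y₆ ∷ Y₅ ∷ Y₄ ∷ Y₃ ∷ Y₂ ∷ Y₁ ∷ 3K₂ ∷ K₃ ∷ [])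
    closed₉ = grows-sound G ¬3K₂ ¬K₃ closed₈ 12 Y₉ 1 10 6 8
      (split 5 12 (use 9 (5 ∷ 12 ∷ 6 ∷ [])) (split 11 12 (use 9 (11 ∷ 12 ∷ 6 ∷ [])) (split 2 13 (use 9
      (2 ∷ 13 ∷ 8 ∷ [])) (split 9 13 (use 9 (9 ∷ 13 ∷ 8 ∷ [])) (split 7 14 (use 8
      (7 ∷ 14 ∷ 1 ∷ 10 ∷ 6 ∷ 8 ∷ [])) (split 7 12 (split 2 12 (use 9 (2 ∷ 12 ∷ 7 ∷ [])) (split 9 12 (use 9
      (9 ∷ 12 ∷ 7 ∷ [])) (split 0 12 (use 8 (0 ∷ 12 ∷ 2 ∷ 8 ∷ 5 ∷ 10 ∷ [])) (split 3 12 (use 8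
      (3 ∷ 12 ∷ 0 ∷ 1 ∷ 8 ∷ 9 ∷ [])) (use 8 (3 ∷ 2 ∷ 12 ∷ 6 ∷ 9 ∷ 10 ∷ [])))))) (split 3 12 (use 8
      (3 ∷ 12 ∷ 1 ∷ 11 ∷ 5 ∷ 7 ∷ [])) (split 3 13 (use 8 (3 ∷ 13 ∷ 1 ∷ 10 ∷ 6 ∷ 12 ∷ [])) (split 0 13 (use 8
      (0 ∷ 13 ∷ 2 ∷ 3 ∷ 9 ∷ 10 ∷ [])) (split 7 13 (use 8 (7 ∷ 13 ∷ 1 ∷ 10 ∷ 6 ∷ 12 ∷ [])) (split 5 13 (split 5
      14 (use 9 (5 ∷ 14 ∷ 13 ∷ [])) (split 11 13 (split 11 14 (use 9 (11 ∷ 14 ∷ 13 ∷ [])) (use 8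
      (11 ∷ 1 ∷ 14 ∷ 12 ∷ 5 ∷ 7 ∷ []))) (use 8 (11 ∷ 9 ∷ 13 ∷ 5 ∷ 2 ∷ 3 ∷ [])))) (use 8
      (5 ∷ 7 ∷ 13 ∷ 8 ∷ 0 ∷ 1 ∷ [])))))))))))))
      refl ∷ closed₈

    closed₁₀ : All Closed (Y₁₀ ∷ Y₉ ∷ Y₈ ∷ Y₇ ∷ Y₆ ∷ Y₅ ∷ Y₄ ∷ Y₃ ∷ Y₂ ∷ Y₁ ∷ 3K₂ ∷ K₃ ∷ [])
    closed₁₀ = grows-sound G ¬3K₂ ¬K₃ closed₉ 13 Y₁₀ 0 4 5 6
      (split 7 13 (use 10 (7 ∷ 13 ∷ 5 ∷ [])) (split 10 13 (use 10 (10 ∷ 13 ∷ 5 ∷ [])) (split 2 15 (use 9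
      (2 ∷ 15 ∷ 0 ∷ 4 ∷ 5 ∷ 6 ∷ [])) (split 12 15 (use 9 (12 ∷ 15 ∷ 0 ∷ 4 ∷ 5 ∷ 6 ∷ [])) (split 1 15 (split 1 13
      (use 10 (1 ∷ 13 ∷ 15 ∷ [])) (split 1 14 (use 10 (1 ∷ 14 ∷ 15 ∷ [])) (split 3 15 (split 3 13 (use 10
      (3 ∷ 13 ∷ 15 ∷ [])) (split 3 14 (use 10 (3 ∷ 14 ∷ 15 ∷ [])) (use 3
      (0 ∷ 4 ∷ 3 ∷ 15 ∷ 1 ∷ 6 ∷ 5 ∷ 14 ∷ 13 ∷ [])))) (use 9 (3 ∷ 4 ∷ 15 ∷ 1 ∷ 5 ∷ 6 ∷ []))))) (split 3 15 (use 9
      (3 ∷ 15 ∷ 0 ∷ 1 ∷ 5 ∷ 6 ∷ [])) (split 2 13 (split 1 13 (use 10 (1 ∷ 13 ∷ 2 ∷ [])) (split 3 13 (use 10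
      (3 ∷ 13 ∷ 2 ∷ [])) (split 8 13 (use 10 (8 ∷ 13 ∷ 2 ∷ [])) (split 9 13 (use 2
      (6 ∷ 5 ∷ 13 ∷ 9 ∷ 8 ∷ 0 ∷ 1 ∷ 4 ∷ 2 ∷ 3 ∷ [])) (use 9 (9 ∷ 8 ∷ 13 ∷ 5 ∷ 0 ∷ 1 ∷ [])))))) (split 9 13
      (split 8 13 (use 10 (8 ∷ 13 ∷ 9 ∷ [])) (split 1 13 (split 11 13 (use 10 (11 ∷ 13 ∷ 1 ∷ [])) (split 3 13
      (split 12 13 (use 2 (6 ∷ 11 ∷ 12 ∷ 10 ∷ 5 ∷ 2 ∷ 3 ∷ 7 ∷ 13 ∷ 9 ∷ [])) (use 9
      (12 ∷ 10 ∷ 13 ∷ 3 ∷ 6 ∷ 8 ∷ []))) (use 9 (3 ∷ 2 ∷ 13 ∷ 9 ∷ 6 ∷ 11 ∷ [])))) (use 3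
      (1 ∷ 0 ∷ 4 ∷ 8 ∷ 2 ∷ 13 ∷ 5 ∷ 9 ∷ 6 ∷ [])))) (split 12 13 (split 11 13 (use 10 (11 ∷ 13 ∷ 12 ∷ [])) (split
      1 13 (split 3 13 (use 9 (3 ∷ 13 ∷ 6 ∷ 11 ∷ 7 ∷ 9 ∷ [])) (use 2
      (2 ∷ 3 ∷ 4 ∷ 0 ∷ 1 ∷ 5 ∷ 6 ∷ 13 ∷ 11 ∷ 12 ∷ []))) (use 9 (1 ∷ 0 ∷ 13 ∷ 12 ∷ 7 ∷ 9 ∷ [])))) (split 3 13
      (use 9 (3 ∷ 13 ∷ 7 ∷ 9 ∷ 10 ∷ 12 ∷ [])) (split 11 13 (split 11 15 (use 10 (11 ∷ 15 ∷ 13 ∷ [])) (split 10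
      15 (use 9 (10 ∷ 15 ∷ 2 ∷ 3 ∷ 6 ∷ 11 ∷ [])) (use 9 (10 ∷ 12 ∷ 15 ∷ 13 ∷ 2 ∷ 3 ∷ [])))) (use 9
      (11 ∷ 12 ∷ 13 ∷ 5 ∷ 2 ∷ 3 ∷ [])))))))))))))
      refl ∷ closed₉

    closed₁₁ : All Closed (Y₁₁ ∷ Y₁₀ ∷ Y₉ ∷ Y₈ ∷ Y₇ ∷ Y₆ ∷ Y₅ ∷ Y₄ ∷ Y₃ ∷ Y₂ ∷ Y₁ ∷ 3K₂ ∷ K₃ ∷ [])
    closed₁₁ = grows-sound G ¬3K₂ ¬K₃ closed₁₀ 10 Y₁₁ 2 3 5 6
      (split 7 10 (use 11 (7 ∷ 10 ∷ 5 ∷ [])) (split 8 11 (use 11 (8 ∷ 11 ∷ 6 ∷ [])) (split 0 12 (use 10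
      (0 ∷ 12 ∷ 2 ∷ 3 ∷ 5 ∷ 6 ∷ [])) (split 9 12 (use 10 (9 ∷ 12 ∷ 2 ∷ 3 ∷ 5 ∷ 6 ∷ [])) (split 4 12 (split 4 10
      (use 11 (4 ∷ 10 ∷ 12 ∷ [])) (split 4 11 (use 11 (4 ∷ 11 ∷ 12 ∷ [])) (split 1 12 (split 1 10 (use 11
      (1 ∷ 10 ∷ 12 ∷ [])) (split 1 11 (use 11 (1 ∷ 11 ∷ 12 ∷ [])) (use 4
      (3 ∷ 2 ∷ 1 ∷ 12 ∷ 4 ∷ 6 ∷ 5 ∷ 11 ∷ 10 ∷ [])))) (use 10 (1 ∷ 2 ∷ 12 ∷ 4 ∷ 5 ∷ 6 ∷ []))))) (split 1 12 (use
      10 (1 ∷ 12 ∷ 3 ∷ 4 ∷ 5 ∷ 6 ∷ [])) (split 0 10 (split 1 10 (use 11 (1 ∷ 10 ∷ 0 ∷ [])) (split 4 10 (use 11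
      (4 ∷ 10 ∷ 0 ∷ [])) (split 0 11 (split 1 11 (use 11 (1 ∷ 11 ∷ 0 ∷ [])) (split 4 11 (use 11
      (4 ∷ 11 ∷ 0 ∷ [])) (use 5 (2 ∷ 3 ∷ 4 ∷ 0 ∷ 1 ∷ 6 ∷ 5 ∷ 11 ∷ 10 ∷ 12 ∷ [])))) (use 10
      (0 ∷ 10 ∷ 11 ∷ 6 ∷ 2 ∷ 3 ∷ []))))) (split 0 11 (use 10 (0 ∷ 11 ∷ 2 ∷ 3 ∷ 5 ∷ 10 ∷ [])) (split 9 10 (split
      8 10 (use 11 (8 ∷ 10 ∷ 9 ∷ [])) (split 9 11 (split 7 11 (use 11 (7 ∷ 11 ∷ 9 ∷ [])) (split 1 10 (split 4 10
      (split 1 11 (split 4 11 (use 1 (3 ∷ 2 ∷ 1 ∷ 0 ∷ 4 ∷ 6 ∷ 5 ∷ 11 ∷ 10 ∷ 9 ∷ 8 ∷ 7 ∷ [])) (use 3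
      (2 ∷ 3 ∷ 4 ∷ 0 ∷ 1 ∷ 6 ∷ 5 ∷ 11 ∷ 10 ∷ 9 ∷ []))) (split 4 11 (use 3
      (0 ∷ 1 ∷ 2 ∷ 3 ∷ 4 ∷ 6 ∷ 5 ∷ 11 ∷ 7 ∷ 9 ∷ [])) (use 5 (11 ∷ 6 ∷ 5 ∷ 7 ∷ 9 ∷ 0 ∷ 1 ∷ 4 ∷ 2 ∷ 3 ∷ []))))
      (split 1 11 (split 4 11 (use 3 (2 ∷ 3 ∷ 4 ∷ 0 ∷ 1 ∷ 5 ∷ 6 ∷ 10 ∷ 11 ∷ 9 ∷ [])) (use 5
      (4 ∷ 3 ∷ 2 ∷ 1 ∷ 0 ∷ 6 ∷ 5 ∷ 11 ∷ 10 ∷ 9 ∷ []))) (split 4 11 (use 3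
      (0 ∷ 1 ∷ 2 ∷ 3 ∷ 4 ∷ 6 ∷ 5 ∷ 11 ∷ 7 ∷ 9 ∷ [])) (use 10 (4 ∷ 3 ∷ 11 ∷ 6 ∷ 1 ∷ 10 ∷ []))))) (split 4 10 (use
      3 (0 ∷ 1 ∷ 2 ∷ 3 ∷ 4 ∷ 5 ∷ 6 ∷ 10 ∷ 8 ∷ 9 ∷ [])) (use 5 (10 ∷ 5 ∷ 6 ∷ 8 ∷ 9 ∷ 0 ∷ 1 ∷ 4 ∷ 2 ∷ 3 ∷ [])))))
      (use 10 (9 ∷ 10 ∷ 11 ∷ 6 ∷ 2 ∷ 3 ∷ [])))) (split 9 11 (use 10 (9 ∷ 11 ∷ 2 ∷ 3 ∷ 5 ∷ 10 ∷ [])) (split 7 12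
      (split 7 11 (use 11 (7 ∷ 11 ∷ 12 ∷ [])) (split 1 11 (split 8 12 (split 8 10 (use 11 (8 ∷ 10 ∷ 12 ∷ []))
      (split 1 10 (split 4 10 (split 4 11 (use 1 (3 ∷ 2 ∷ 1 ∷ 0 ∷ 4 ∷ 6 ∷ 5 ∷ 11 ∷ 10 ∷ 12 ∷ 8 ∷ 7 ∷ [])) (use 3
      (2 ∷ 3 ∷ 4 ∷ 0 ∷ 1 ∷ 6 ∷ 5 ∷ 11 ∷ 10 ∷ 12 ∷ []))) (split 4 11 (use 3
      (2 ∷ 3 ∷ 4 ∷ 0 ∷ 1 ∷ 5 ∷ 6 ∷ 10 ∷ 11 ∷ 12 ∷ [])) (use 5 (4 ∷ 3 ∷ 2 ∷ 1 ∷ 0 ∷ 6 ∷ 5 ∷ 11 ∷ 10 ∷ 12 ∷ []))))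
      (use 10 (1 ∷ 0 ∷ 10 ∷ 5 ∷ 8 ∷ 9 ∷ [])))) (use 10 (8 ∷ 6 ∷ 12 ∷ 7 ∷ 0 ∷ 1 ∷ []))) (use 10
      (1 ∷ 0 ∷ 11 ∷ 6 ∷ 7 ∷ 9 ∷ [])))) (split 1 10 (split 8 12 (use 10 (8 ∷ 12 ∷ 0 ∷ 1 ∷ 5 ∷ 7 ∷ [])) (split 1
      11 (split 4 10 (split 8 10 (use 11 (8 ∷ 10 ∷ 4 ∷ [])) (split 4 11 (split 7 11 (use 11 (7 ∷ 11 ∷ 4 ∷ []))
      (use 0 (0 ∷ 1 ∷ 2 ∷ 3 ∷ 4 ∷ 5 ∷ 6 ∷ 7 ∷ 8 ∷ 9 ∷ 10 ∷ 11 ∷ 12 ∷ []))) (use 3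
      (2 ∷ 3 ∷ 4 ∷ 0 ∷ 1 ∷ 6 ∷ 5 ∷ 11 ∷ 10 ∷ 12 ∷ [])))) (split 4 11 (use 3
      (2 ∷ 3 ∷ 4 ∷ 0 ∷ 1 ∷ 5 ∷ 6 ∷ 10 ∷ 11 ∷ 12 ∷ [])) (use 5 (4 ∷ 3 ∷ 2 ∷ 1 ∷ 0 ∷ 6 ∷ 5 ∷ 11 ∷ 10 ∷ 12 ∷ []))))
      (use 10 (1 ∷ 0 ∷ 11 ∷ 12 ∷ 8 ∷ 9 ∷ [])))) (use 10 (1 ∷ 0 ∷ 10 ∷ 12 ∷ 7 ∷ 9 ∷ []))))))))))))))
      refl ∷ closed₁₀

    -- The pentagon 5 7 9 8 6 grown on the edge 5 6 has no edges to 0 and 1, so only the adjacencies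
    -- between 7, 8, 9 and 2, 3, 4 are open.
    closed₁₂ : All Closed (Y₁₂ ∷ Y₁₁ ∷ Y₁₀ ∷ Y₉ ∷ Y₈ ∷ Y₇ ∷ Y₆ ∷ Y₅ ∷ Y₄ ∷ Y₃ ∷ Y₂ ∷ Y₁ ∷ 3K₂ ∷ K₃ ∷ [])
    closed₁₂ = grows-sound G ¬3K₂ ¬K₃ closed₁₁ 7 Y₁₂ 0 1 5 6
      (split 3 9 (use 11 (3 ∷ 9 ∷ 0 ∷ 1 ∷ 5 ∷ 6 ∷ [])) (split 3 7 (split 2 7 (use 12 (2 ∷ 7 ∷ 3 ∷ [])) (split 4
      7 (use 12 (4 ∷ 7 ∷ 3 ∷ [])) (split 3 8 (split 2 8 (use 12 (2 ∷ 8 ∷ 3 ∷ [])) (split 4 8 (use 12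
      (4 ∷ 8 ∷ 3 ∷ [])) (use 5 (1 ∷ 0 ∷ 4 ∷ 3 ∷ 2 ∷ 6 ∷ 5 ∷ 8 ∷ 7 ∷ [])))) (use 11
      (3 ∷ 7 ∷ 8 ∷ 6 ∷ 0 ∷ 1 ∷ []))))) (split 3 8 (use 11 (3 ∷ 8 ∷ 0 ∷ 1 ∷ 5 ∷ 7 ∷ [])) (split 2 9 (split 2 7
      (use 12 (2 ∷ 7 ∷ 9 ∷ [])) (split 2 8 (use 12 (2 ∷ 8 ∷ 9 ∷ [])) (split 4 9 (split 4 7 (use 12
      (4 ∷ 7 ∷ 9 ∷ [])) (split 4 8 (use 12 (4 ∷ 8 ∷ 9 ∷ [])) (use 6
      (5 ∷ 6 ∷ 8 ∷ 9 ∷ 7 ∷ 0 ∷ 1 ∷ 4 ∷ 2 ∷ 3 ∷ [])))) (use 11 (4 ∷ 0 ∷ 9 ∷ 2 ∷ 5 ∷ 6 ∷ []))))) (split 4 9 (use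
      11 (4 ∷ 9 ∷ 1 ∷ 2 ∷ 5 ∷ 6 ∷ [])) (split 2 7 (split 4 7 (split 2 8 (split 4 8 (use 0
      (1 ∷ 0 ∷ 4 ∷ 3 ∷ 2 ∷ 6 ∷ 5 ∷ 8 ∷ 7 ∷ 9 ∷ [])) (use 4 (1 ∷ 0 ∷ 4 ∷ 3 ∷ 2 ∷ 6 ∷ 5 ∷ 8 ∷ 7 ∷ 9 ∷ []))) (split
      4 8 (use 4 (0 ∷ 1 ∷ 2 ∷ 3 ∷ 4 ∷ 6 ∷ 5 ∷ 8 ∷ 7 ∷ 9 ∷ [])) (use 6
      (8 ∷ 6 ∷ 5 ∷ 7 ∷ 9 ∷ 0 ∷ 1 ∷ 4 ∷ 2 ∷ 3 ∷ [])))) (split 2 8 (split 4 8 (use 4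
      (1 ∷ 0 ∷ 4 ∷ 3 ∷ 2 ∷ 5 ∷ 6 ∷ 7 ∷ 8 ∷ 9 ∷ [])) (use 6 (4 ∷ 0 ∷ 1 ∷ 2 ∷ 3 ∷ 6 ∷ 5 ∷ 8 ∷ 7 ∷ 9 ∷ []))) (split
      4 8 (use 3 (1 ∷ 0 ∷ 4 ∷ 3 ∷ 2 ∷ 6 ∷ 5 ∷ 8 ∷ 7 ∷ 9 ∷ [])) (use 11 (4 ∷ 0 ∷ 8 ∷ 6 ∷ 2 ∷ 7 ∷ []))))) (split 4
      7 (split 2 8 (split 4 8 (use 4 (0 ∷ 1 ∷ 2 ∷ 3 ∷ 4 ∷ 5 ∷ 6 ∷ 7 ∷ 8 ∷ 9 ∷ [])) (use 3
      (1 ∷ 0 ∷ 4 ∷ 3 ∷ 2 ∷ 5 ∷ 6 ∷ 7 ∷ 8 ∷ 9 ∷ []))) (split 4 8 (use 6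
      (1 ∷ 2 ∷ 3 ∷ 4 ∷ 0 ∷ 6 ∷ 5 ∷ 8 ∷ 7 ∷ 9 ∷ [])) (use 11 (4 ∷ 7 ∷ 8 ∷ 6 ∷ 1 ∷ 2 ∷ [])))) (split 2 8 (split 4
      8 (use 6 (5 ∷ 7 ∷ 9 ∷ 8 ∷ 6 ∷ 0 ∷ 1 ∷ 4 ∷ 2 ∷ 3 ∷ [])) (use 11 (4 ∷ 0 ∷ 8 ∷ 2 ∷ 5 ∷ 7 ∷ []))) (split 4 8
      (use 11 (4 ∷ 8 ∷ 1 ∷ 2 ∷ 5 ∷ 7 ∷ [])) (use 7 (4 ∷ 0 ∷ 1 ∷ 2 ∷ 3 ∷ 8 ∷ 6 ∷ 5 ∷ 7 ∷ 9 ∷ [])))))))))))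
      refl ∷ closed₁₁

    -- A pentagon through the second edge misses both ends of the first, which is C₅ ∪ K₂.
    closed₁₃ : All Closed (Y₁₃ ∷ Y₁₂ ∷ Y₁₁ ∷ Y₁₀ ∷ Y₉ ∷ Y₈ ∷ Y₇ ∷ Y₆ ∷ Y₅ ∷ Y₄ ∷ Y₃ ∷ Y₂ ∷ Y₁ ∷ 3K₂ ∷ K₃ ∷ [])
    closed₁₃ = grows-sound G ¬3K₂ ¬K₃ closed₁₂ 4 Y₁₃ 0 1 2 3
      (use 0 (2 ∷ 3 ∷ 5 ∷ 6 ∷ 4 ∷ 0 ∷ 1 ∷ []))
      refl ∷ closed₁₂

  -- Without a 2K₂, Wagon's bound gives three colours; a 2K₂ is the closed pattern `Y₁₃`.
  four-colouring₃ : Colouring G 4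
  four-colouring₃ with matching? 2 G
  ... | no ¬2K₂ = relax {G} (ℕₚ.n≤1+n 3) (wagon 2 G ¬2K₂ ¬K₃)
  ... | yes (a , b , ab , ((u , au) , bu) , ((v , av) , bv) , uv , _) =
    All.head closed₁₃ (nth a (a ∷ b ∷ u ∷ v ∷ []))
      (ab ∷ unnot au ∷ unnot bu ∷ unnot av ∷ unnot bv ∷ uv ∷ [])

-- Induction on p

module _ (G : FinGraph) (gem⁺-free : Gem⁺-free G) where
  private
    _≈_ = _~_ G

  -- The common neighbours of `u` and `v` take C(k+1, 2) colours, the vertices seeing exactly one of
  -- them `suc k` for either end, and the common non-neighbours `c`. Pascal's rule merges the first
  -- two numbers.
  far-colouring : ∀ k {c u v} → ¬ Clique G (suc (suc (suc k))) → u ≈ v ≡ true →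
    Colouring (far G u v) c → Colouring G (suc (suc k) C 2 + (suc k + c))
  far-colouring k {c} {u} {v} ¬K uv χ =
    subst (λ a → Colouring G (a + (suc k + c))) (C₂-step (suc k))
      (glue G (u ≈_)
        (glue (sub G (u ≈_)) (_≈_ v ∘ proj₁)
          (P₄+K₁-free-colouring k (sub (sub G (u ≈_)) (_≈_ v ∘ proj₁)) (gem⁺-free u ∘ lift-P₄+K₁)
            (¬K ∘ extend-sub G u (λ _ p → p) ∘ extend-sub (sub G (u ≈_)) (v , uv) (λ _ p → p)))
          (P₄-free-colouring (suc k) (sub (sub G (u ≈_)) (not ∘ _≈_ v ∘ proj₁)) ¬P₄-left
            (¬K ∘ extend-sub G u (λ _ p → p) ∘ lift (sub G (u ≈_)))))
        (glue (sub G (not ∘ _≈_ u)) (_≈_ v ∘ proj₁)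
          (P₄-free-colouring (suc k) (sub (sub G (not ∘ _≈_ u)) (_≈_ v ∘ proj₁)) ¬P₄-right
            (λ Q → ¬K (extend G v (lift G (lift (sub G (not ∘ _≈_ u)) Q)) (proj₂ ∘ proj₁ Q))))
          χ))
    where
    ¬P₄-left : ¬ P₄ (sub (sub G (u ≈_)) (not ∘ _≈_ v ∘ proj₁))
    ¬P₄-left P@(p₄ {_ , p} {_ , q} {_ , r} {_ , s} _ _ _ _ _ _) = gem⁺-free u
      (p₄+k₁ (lift-P₄ P) {v , uv} (unnot p) (unnot q) (unnot r) (unnot s))
    ¬P₄-right : ¬ P₄ (sub (sub G (not ∘ _≈_ u)) (_≈_ v ∘ proj₁))
    ¬P₄-right (p₄ {(a , a′) , p} {(b , b′) , q} {(c , c′) , r} {(d , d′) , s} ab bc cd ac bd ad) =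
      gem⁺-free v (p₄+k₁ (p₄ {a = a , p} {b , q} {c , r} {d , s} ab bc cd ac bd ad) {u , ≈-sym G uv}
        (unnot a′) (unnot b′) (unnot c′) (unnot d′))

edge? : ∀ G → Dec (∃ λ u → ∃ λ v → _~_ G u v ≡ true)
edge? G = exists? G λ u → exists? G λ v → _~_ G u v Boolₚ.≟ true

-- Wagon's bound is 3 at `w = 2` and already the required value from `w = 4` on; at `w = 3` it is 6,
-- and `four-colouring₂` improves it to 4.
bound₂ : ∀ w G → ¬ Matching G 2 → Gem⁺-free G → ¬ Clique G (suc w) → Colouring G (f₂ w)
bound₂ 0 G ¬M gem⁺-free ¬K = no-vertices G ¬K
bound₂ 1 G ¬M gem⁺-free ¬K = edgeless G ¬K
bound₂ 2 G ¬M gem⁺-free ¬K = wagon 2 G ¬M ¬K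
bound₂ 3 G ¬M gem⁺-free ¬K = four-colouring₂ G ¬M gem⁺-free ¬K
bound₂ w@(suc (suc (suc (suc _)))) G ¬M gem⁺-free ¬K = wagon w G ¬M ¬K

-- The common non-neighbours of an edge inherit the hypotheses, with an induced matching bound
-- smaller by one. A graph without edges needs one colour, and `d` is at least `suc k + c`.
peel : ∀ p k {c d} G → Gem⁺-free G → ¬ Clique G (suc (suc (suc k))) → ¬ Matching G (suc p) →
  suc (suc k) C 2 + (suc k + c) ≤ d →
  (∀ {u v} → ¬ Matching (far G u v) p → Gem⁺-free (far G u v) →
    ¬ Clique (far G u v) (suc (suc (suc k))) → Colouring (far G u v) c) →
  Colouring G d
peel p k {c} G gem⁺-free ¬K ¬M c≤d far-bound with edge? G
... | yes (u , v , uv) = relax {G} c≤d (far-colouring G gem⁺-free k ¬K uv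
        (far-bound (λ M → ¬M (u , v , uv , M)) far-gem⁺-free (¬K ∘ lift G ∘ lift (sub G (not ∘ _~_ G u)))))
  where
  far-gem⁺-free : Gem⁺-free (far G u v)
  far-gem⁺-free ((x , _) , _) (p₄+k₁ (p₄ {(a , _) , p} {(b , _) , q} {(c , _) , r} {(d , _) , s}
                                ab bc cd ac bd ad) {(z , _) , t} za zb zc zd) =
    gem⁺-free x (p₄+k₁ (p₄ {a = proj₁ a , p} {proj₁ b , q} {proj₁ c , r} {proj₁ d , s} ab bc cd ac bd ad)
      {proj₁ z , t} za zb zc zd)
... | no none = relax {G} (ℕₚ.≤-trans (ℕₚ.m≤n⇒m≤o+n (suc (suc k) C 2) (s≤s z≤n)) c≤d)
                  (monochrome {G} λ u v e → none (u , v , e))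

-- One step of the induction spends C(w, 2) + w - 1 new colours, while the recurrence for `f` grants
-- C(w+1, 2) + w - 2, which is larger by w - 1.
room : ∀ c k → let w = suc (suc (suc k)) in w C 2 + (suc (suc k) + c) ≤ c + suc w C 2 + w ∸ 2
room c k = begin
  w C 2 + (suc (suc k) + c)        ≡⟨ ℕₚ.+-assoc (w C 2) _ c ⟨
  w C 2 + suc (suc k) + c          ≡⟨ ℕₚ.+-comm _ c ⟩
  c + (w C 2 + suc (suc k))        ≤⟨ ℕₚ.+-monoʳ-≤ c (ℕₚ.+-monoʳ-≤ (w C 2) (ℕₚ.n≤1+n _)) ⟩
  c + (w C 2 + w)                  ≡⟨ cong (c +_) (C₂-step w) ⟩
  c + suc w C 2                    ≤⟨ ℕₚ.m≤m+n _ (suc k) ⟩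
  c + suc w C 2 + suc k            ≡⟨ ℕₚ.+-∸-assoc (c + suc w C 2) (s≤s (s≤s z≤n)) ⟨
  c + suc w C 2 + w ∸ 2            ∎
  where
  open ℕₚ.≤-Reasoning
  w = suc (suc (suc k))

bound : ∀ p w G → 2 ≤ p → ¬ Matching G p → Gem⁺-free G → ¬ Clique G (suc w) → Colouring G (f p w)
bound 1 w G (s≤s ()) ¬M gem⁺-free ¬K
bound 2 w G _ ¬M gem⁺-free ¬K = bound₂ w G ¬M gem⁺-free ¬K
bound (suc (suc (suc p))) 0 G _ ¬M gem⁺-free ¬K = no-vertices G ¬K
bound (suc (suc (suc p))) 1 G _ ¬M gem⁺-free ¬K = edgeless G ¬K
-- Removing an edge would give 2 + 3 = 5 colours here, one more than `f 3 2`; from p = 4 on the two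
-- additional colours per edge match the growth of `f p 2`.
bound 3 2 G _ ¬M gem⁺-free ¬K = four-colouring₃ G ¬M ¬K
bound (suc (suc (suc (suc p)))) 2 G _ ¬M gem⁺-free ¬K =
  peel (suc (suc (suc p))) 0 G gem⁺-free ¬K ¬M
    (ℕₚ.≤-reflexive (cong (2 +_) (sym (ℕₚ.+-suc p _)))) λ {u} {v} →
    bound (suc (suc (suc p))) 2 (far G u v) (s≤s (s≤s z≤n))
bound (suc (suc (suc p))) w@(suc (suc (suc k))) G _ ¬M gem⁺-free ¬K =
  peel (suc (suc p)) (suc k) G gem⁺-free ¬K ¬M (room (f (suc (suc p)) w) k) λ {u} {v} →
    bound (suc (suc p)) w (far G u v) (s≤s (s≤s z≤n))

-- Transfer to the graphs of the statement

finGraph : ∀ {n} → Graph n → FinGraph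
finGraph {n} G = record
  { V = Fin n ; _~_ = adj G ; ~-sym = adj-sym G ; ~-irrefl = adj-irrefl G
  ; vertices = allFin n ; complete = ∈-allFin }

~⇒≢ : ∀ G {u v} → _~_ G u v ≡ true → u ≢ v
~⇒≢ G e refl = true≢false e (~-irrefl G _)

-- Injectivity comes from irreflexivity: two members of the clique with the same image would form a
-- loop.
hasClique : ∀ {n k} (G : Graph n) → Clique (finGraph G) k → HasClique G k
hasClique G (q , clique) = q , injective , clique
  where
  injective : ∀ {i j} → q i ≡ q j → i ≡ j
  injective {i} {j} eq with i Fin.≟ j
  ... | yes i≡j = i≡j
  ... | no i≢j  = ⊥-elim (~⇒≢ (finGraph G) (clique i j i≢j) eq)

-- Decided by evaluation over all pairs. The pattern has no facts on the diagonal, so `i ≡ j` is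
-- split off.
gem⁺-pattern-complete : ∀ i j → i ≡ j ⊎ entails gem⁺-pattern (toℕ i , toℕ j , adj gem⁺ i j) ≡ true
gem⁺-pattern-complete = toWitness {a? = Finₚ.all? λ i → Finₚ.all? λ j →
  (i Fin.≟ j) ⊎-dec (entails gem⁺-pattern (toℕ i , toℕ j , adj gem⁺ i j) Boolₚ.≟ true)} tt

-- A map that preserves adjacency and non-adjacency is injective on a graph without twins, so the
-- six vertices of a gem⁺ are distinct by their adjacencies alone.
gem⁺-twin-free : ∀ i j → (∀ k → adj gem⁺ i k ≡ adj gem⁺ j k) → i ≡ j
gem⁺-twin-free = toWitness {a? = Finₚ.all? λ i → Finₚ.all? λ j →
  Finₚ.all? (λ k → adj gem⁺ i k Boolₚ.≟ adj gem⁺ j k) →-dec (i Fin.≟ j)} tt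

gem⁺-free : ∀ {n} (G : Graph n) → Free gem⁺ G → Gem⁺-free (finGraph G)
gem⁺-free {n} G free u
  (p₄+k₁ (p₄ {a , ua} {b , ub} {c , uc} {d , ud} ab bc cd ac bd ad) {z , uz} za zb zc zd) =
  free (ρ ∘ toℕ , injective , induced)
  where
  open Semantics (finGraph G)
  flip : ∀ {x y s} → adj G x y ≡ s → adj G y x ≡ s
  flip = ≈-sym (finGraph G)
  ρ : Assignment
  -- The default value `z` serves as the vertex named 5, the pendant one.
  ρ = nth z (a ∷ b ∷ c ∷ d ∷ u ∷ [])
  facts : All (ρ ⊨_) gem⁺-pattern
  facts = ab ∷ ac ∷ bc ∷ ad ∷ bd ∷ cd ∷ flip ua ∷ flip ub ∷ flip uc ∷ flip ud ∷
          flip za ∷ flip zb ∷ flip zc ∷ flip zd ∷ uz ∷ []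
  induced : ∀ i j → adj G (ρ (toℕ i)) (ρ (toℕ j)) ≡ adj gem⁺ i j
  induced i j with gem⁺-pattern-complete i j
  ... | inj₁ refl = trans (adj-irrefl G _) (sym (adj-irrefl gem⁺ i))
  ... | inj₂ e    = entails-sound gem⁺-pattern (toℕ i , toℕ j , adj gem⁺ i j) e facts
  injective : ∀ {i j} → ρ (toℕ i) ≡ ρ (toℕ j) → i ≡ j
  injective {i} {j} eq = gem⁺-twin-free i j λ k →
    trans (sym (induced i k)) (trans (cong (λ x → adj G x (ρ (toℕ k))) eq) (induced j k))

-- Induced matchings as copies of `pK2`

module _ (G : FinGraph) {S : V G → Bool} where
  sub-≡ : {x y : V (sub G S)} → proj₁ x ≡ proj₁ y → x ≡ y
  sub-≡ {_ , p} {_ , q} refl = cong (_ ,_) (Decidable⇒UIP.≡-irrelevant Boolₚ._≟_ p q)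

-- Indices past the last edge of the matching get a junk value.
ends : ∀ p G → Matching G (suc p) → ℕ → V G
ends p       G (u , v , _ , M) 0             = u
ends p       G (u , v , _ , M) 1             = v
ends zero    G (u , v , _ , M) (suc (suc i)) = u
ends (suc p) G (u , v , _ , M) (suc (suc i)) = proj₁ (proj₁ (ends p (far G u v) M i))

halve : ∀ i → suc (suc i) / 2 ≡ suc (i / 2)
halve i = +-distrib-/-∣ˡ {2} i {2} (divides 1 refl)

drop-edge : ∀ {p i} → suc (suc i) < suc (suc p) + suc (suc p) → i < suc p + suc p
drop-edge {p} {i} lt rewrite ℕₚ.+-suc p (suc p) = s≤s⁻¹ (s≤s⁻¹ lt)

-- Later ends lie in `far G u v`, so they miss `u` and `v`. Between later ends the claim passes to
-- the smaller matching, where both edge indices drop by one.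
ends-adj : ∀ p G M {i j} → i < suc p + suc p → j < suc p + suc p →
  _~_ G (ends p G M i) (ends p G M j) ≡ pK2-adj i j
ends-adj p G (u , v , uv , M) {0} {0} _ _ = ~-irrefl G u
ends-adj p G (u , v , uv , M) {0} {1} _ _ = uv
ends-adj p G (u , v , uv , M) {1} {0} _ _ = ≈-sym G uv
ends-adj p G (u , v , uv , M) {1} {1} _ _ = ~-irrefl G v
ends-adj zero G _ {suc (suc i)} (s≤s (s≤s ())) _
ends-adj zero G _ {0} {suc (suc j)} _ (s≤s (s≤s ()))
ends-adj zero G _ {1} {suc (suc j)} _ (s≤s (s≤s ()))
ends-adj (suc p) G (u , v , uv , M) {0} {suc (suc j)} _ _ rewrite halve j =
  unnot (proj₂ (proj₁ (ends p (far G u v) M j)))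
ends-adj (suc p) G (u , v , uv , M) {1} {suc (suc j)} _ _ rewrite halve j =
  unnot (proj₂ (ends p (far G u v) M j))
ends-adj (suc p) G (u , v , uv , M) {suc (suc i)} {0} _ _ rewrite halve i =
  ≈-sym G (unnot (proj₂ (proj₁ (ends p (far G u v) M i))))
ends-adj (suc p) G (u , v , uv , M) {suc (suc i)} {1} _ _ rewrite halve i =
  ≈-sym G (unnot (proj₂ (ends p (far G u v) M i)))
ends-adj (suc p) G (u , v , uv , M) {suc (suc i)} {suc (suc j)} i< j< rewrite halve i | halve j =
  ends-adj p (far G u v) M (drop-edge i<) (drop-edge j<)

-- `u` and `v` see each other, while each later end misses both; this separates the first edge from
-- the rest.
ends-injective : ∀ p G M {i j} → i < suc p + suc p → j < suc p + suc p →
  ends p G M i ≡ ends p G M j → i ≡ j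
ends-injective p G (u , v , uv , M) {0} {0} _ _ eq = refl
ends-injective p G (u , v , uv , M) {1} {1} _ _ eq = refl
ends-injective p G (u , v , uv , M) {0} {1} _ _ eq = ⊥-elim (~⇒≢ G uv eq)
ends-injective p G (u , v , uv , M) {1} {0} _ _ eq = ⊥-elim (~⇒≢ G uv (sym eq))
ends-injective zero G _ {suc (suc i)} (s≤s (s≤s ())) _
ends-injective zero G _ {0} {suc (suc j)} _ (s≤s (s≤s ()))
ends-injective zero G _ {1} {suc (suc j)} _ (s≤s (s≤s ()))
ends-injective (suc p) G (u , v , uv , M) {suc (suc i)} {suc (suc j)} i< j< eq =
  cong (2 +_) (ends-injective p (far G u v) M (drop-edge i<) (drop-edge j<)
    (sub-≡ (sub G (not ∘ _~_ G u)) (sub-≡ G eq)))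
ends-injective (suc p) G (u , v , uv , M) {0} {suc (suc j)} _ _ eq =
  ⊥-elim (true≢false (≈-sym G uv) (subst (λ x → _~_ G v x ≡ false) (sym eq) (unnot (proj₂ (ends p (far G u v) M j)))))
ends-injective (suc p) G (u , v , uv , M) {1} {suc (suc j)} _ _ eq =
  ⊥-elim (true≢false uv (subst (λ x → _~_ G u x ≡ false) (sym eq) (unnot (proj₂ (proj₁ (ends p (far G u v) M j))))))
ends-injective (suc p) G (u , v , uv , M) {suc (suc i)} {0} _ _ eq =
  ⊥-elim (true≢false (≈-sym G uv) (subst (λ x → _~_ G v x ≡ false) eq (unnot (proj₂ (ends p (far G u v) M i)))))
ends-injective (suc p) G (u , v , uv , M) {suc (suc i)} {1} _ _ eq =
  ⊥-elim (true≢false uv (subst (λ x → _~_ G u x ≡ false) eq (unnot (proj₂ (proj₁ (ends p (far G u v) M i))))))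

matching-free : ∀ {n} p (G : Graph n) → Free (pK2 (suc p)) G → ¬ Matching (finGraph G) (suc p)
matching-free p G free M = free
  ( ends p H M ∘ toℕ
  , (λ {i} {j} eq → Finₚ.toℕ-injective (ends-injective p H M (Finₚ.toℕ<n i) (Finₚ.toℕ<n j) eq))
  , λ i j → ends-adj p H M (Finₚ.toℕ<n i) (Finₚ.toℕ<n j))
  where H = finGraph G

theorem3p9 : (p : ℕ) → 2 ≤ p → (n : ℕ) (G : Graph n) →
    Free (pK2 p) G → Free gem⁺ G →
    (w : ℕ) → IsCliqueNumber G w → Colourable G (f p w)
theorem3p9 (suc p) 2≤p n G pK₂-free G-gem⁺-free w (_ , maximal) =
  bound (suc p) w (finGraph G) 2≤p (matching-free p G pK₂-free) (gem⁺-free G G-gem⁺-free)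
    λ Q → ℕₚ.1+n≰n (maximal (suc w) (hasClique G Q))
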